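{- Let $m>1$ be an integer. For a positive integer $N$ let $w(N)$ denote the number of distinct prime divisors of $N$, and let $\left(\frac{\cdot}{5}\right)$ denote the Legendre symbol modulo $5$. Then: 1. There exists an $m$-Markoff triple of the form $(1,b,c)$ if and only if $m-1=S^2C$ with $S$ a positive integer and $C$ square-free such that every prime $p\mid C$ satisfies $\left(\frac{p}{5}\right)\ne -1$. 2. Suppose there exists an $m$-Markoff triple $(1,b,c)$. Write $m-1=5^{2\alpha}A^2B^2C$, where $\alpha\ge 0$, $C$ is square-free with every prime $p\mid C$ satisfying $\left(\frac{p}{5}\right)\ne -1$, every prime $p\mid B$ satisfies $\left(\frac{p}{5}\right)=1$, and every prime $p\mid A$ satisfies $\left(\frac{p}{5}\right)=-1$. Then the number of minimal triples of the form $(1,b,c)$ equals $$\sum_{d\mid B} 2^{\,w\left(\frac{B^2C}{d^2}\right)+l-1},\qquad \text{where } l=\left(\tfrac{C}{5}\right).$$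
   Context: An $m$-Markoff triple is a triple $(a,b,c)$ of positive integers with $a^2+b^2+c^2=3abc+m$. A minimal triple is an $m$-Markoff triple $(a,b,c)$ with $a\le b\le c$ and $3ab-c\le 0$. The sum in part 2 runs over the positive divisors $d$ of $B$. -}

module Defs where

open import Data.Nat using (ℕ; zero; suc; _+_; _*_; _∸_; _^_; _≤_; _<_; _≡ᵇ_)
open import Data.Nat.DivMod using (_%_; _/_)
open import Data.Nat.Divisibility using (_∣_; _∣?_)
open import Data.Nat.Primality using (Prime; prime?)
open import Data.Integer as ℤ using (ℤ; +_; -[1+_])
open import Data.List using (List; []; _∷_; filter; upTo; length; map)
open import Data.Nat.ListAction using (sum)
open import Data.Bool.ListAction using (any)
open import Data.Bool using (Bool; true; false; if_then_else_)
open import Data.Product using (_×_; _,_; Σ; ∃)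
open import Relation.Binary.PropositionalEquality using (_≡_)
open import Relation.Nullary using (¬_)

MarkoffTriple : ℕ → ℕ × ℕ × ℕ → Set
MarkoffTriple m (a , b , c) =
  1 ≤ a × 1 ≤ b × 1 ≤ c × a * a + b * b + c * c ≡ 3 * a * b * c + m

MinimalTriple : ℕ → ℕ × ℕ × ℕ → Set
MinimalTriple m (a , b , c) = MarkoffTriple m (a , b , c) × a ≤ b × b ≤ c × 3 * a * b ≤ c

MinimalTriplesWith1 : ℕ → Set
MinimalTriplesWith1 m = Σ (ℕ × ℕ × ℕ) λ { (a , b , c) → a ≡ 1 × MinimalTriple m (a , b , c) }

SquareFree : ℕ → Set
SquareFree n = ∀ p → Prime p → ¬ (p * p ∣ n)

isSquareMod5 : ℕ → Bool
isSquareMod5 a = any (λ x → ((x * x) % 5) ≡ᵇ (a % 5)) (upTo 5)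

legendre5 : ℕ → ℤ
legendre5 a =
  if (a % 5) ≡ᵇ 0 then + 0
  else if isSquareMod5 a then + 1
  else -[1+ 0 ]

primeDivisors : ℕ → List ℕ
primeDivisors n = filter (λ p → p ∣? n) (filter prime? (upTo (suc n)))

ω : ℕ → ℕ
ω n = length (primeDivisors n)

divisorsPred : ℕ → List ℕ
divisorsPred B = filter (λ k → suc k ∣? B) (upTo B)

-- Σ_{d ∣ B} 2^{ w(B²C/d²) + l - 1 },  l = (C/5).
-- The exponent is an integer; under the hypotheses of the theorem it is ≥ 0
-- (l ∈ {0,1}, and l = 0 forces 5 ∣ C so w ≥ 1), so we take its absolute value.
markoffCount : ℕ → ℕ → ℕ
markoffCount B C =
  sum (map (λ k → 2 ^ ℤ.∣ (+ ω ((B * B * C) / (suc k * suc k))) ℤ.+ legendre5 C ℤ.- + 1 ∣)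
           (divisorsPred B))

{-# OPTIONS --safe #-}
-- With n = m - 1 and c = v + 3b, the minimal triples (1, b, c) are the pairs b ≥ 1, v ≥ 0 with
-- Q(b, v) = b² + 3bv + v² = n, a form of discriminant 5.  Sending a primitive pair to its slope v/b identifies
-- the primitive representations of k with the roots of f(x) = x² + 3x + 1 modulo k: two pairs with the same slope
-- are proportional for size reasons, and a root is turned into a pair by a Euclidean descent on
-- k k′ = x² + 3x + 1.  The roots are counted by the Chinese remainder theorem and Hensel lifting: two for each prime
-- p ≡ ±1 (mod 5), one for 5, none for 25 and, as Q is a square modulo 5, none for p ≡ ±2 (mod 5).
-- That a prime p ≡ ±1 (mod 5) has a root follows without quadratic reciprocity from a map of order 5 on a set of
-- 1 + p² elements whose fixed points give roots.  Finally g = gcd(b, v) must be a multiple of 5^α A, and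
-- writing g = 5^α A d leaves exactly the divisors d of B, with primitive pairs of value B²C/d².

module Submission where

open import Defs

-- Behind the bijection between primitive pairs and roots stands the ring ℤ[η] with η = (3 + √5) /
-- 2: `Q b v` is the norm of b + v η, and η is itself a unit of norm 1. So Q has infinitely many
-- automorphs, and over ℤ a positive value is taken infinitely often or never. The condition b ≥ 1,
-- v ≥ 0 cuts out the half-open cone between 1 and η, a fundamental domain for multiplication by η
-- on the totally positive elements; this is why a root belongs to at most one pair. That it belongs
-- to at least one is class number one for discriminant 5. The criterion for existence concerns
-- arbitrary triples, and c < 3 b would make v negative. There the equation is read as Q(b, -c) = m
-- - 1 over ℤ, and only the root obtained from it is used; no descent to a minimal triple takes
-- place.

module Development where

  open import Data.Bool using (if_then_else_)
  open import Data.Bool.ListAction using (any)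
  open import Data.Empty using (⊥-elim)
  open import Data.Fin as Fin using (Fin; toℕ; fromℕ<)
  import Data.Fin.Properties as Fin
  open import Data.Integer as ℤ using (ℤ; +_; -[1+_]; _+_; _*_; _-_; -_; 0ℤ; 1ℤ)
  open import Data.Integer.Divisibility.Signed as ℤ∣ using (_∣_; divides)
  open import Data.Integer.DivMod using (_%ℕ_; _/ℕ_; n%ℕd<d; a≡a%ℕn+[a/ℕn]*n)
  import Data.Integer.Properties as ℤ
  open import Data.Integer.Tactic.RingSolver using (solve-∀)
  open import Data.List as List using (List; []; _∷_; _++_; length; filter; allFin; upTo; map)
  import Data.List.Properties as List
  open import Data.List.Membership.Propositional using (_∈_; _∉_)
  open import Data.List.Membership.Propositional.Properties using (∈-map⁺; ∈-filter⁺; ∈-filter⁻; ∈-++⁺ˡ; ∈-++⁺ʳ; ∈-++⁻; ∈-allFin; ∈-upTo⁺)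
  open import Data.List.Membership.Propositional.Properties.WithK using (unique∧set⇒bag; unique⇒irrelevant)
  open import Data.List.Relation.Binary.BagAndSetEquality using (∼bag⇒↭)
  open import Data.List.Relation.Binary.Permutation.Propositional.Properties using (↭-length)
  open import Data.List.Relation.Unary.All using (All; []; _∷_)
  open import Data.List.Relation.Unary.AllPairs using ([]; _∷_)
  open import Data.List.Relation.Unary.Any using (here; there)
  open import Data.List.Relation.Unary.Unique.Propositional using (Unique)
  import Data.List.Relation.Unary.Unique.Propositional.Properties as Unique
  open import Data.Nat as ℕ using (ℕ; zero; suc)
  open import Data.Nat.Coprimality using (Coprime; coprime-Bézout; coprime-divisor; gcd≡1⇒coprime; coprime⇒gcd≡1)
  import Data.Nat.Divisibility as ℕ∣
  open import Data.Nat.Divisibility using (m%n≡0⇒n∣m; n∣m⇒m%n≡0)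
  open import Data.Nat.DivMod using (_%_; _/_; m%n<n; %-distribˡ-+; %-distribˡ-*; [m+kn]%n≡m%n; m*n/n≡m; m/n*n≡m)
  open import Data.Nat.GCD using (gcd; gcd[m,n]∣m; gcd[m,n]∣n; c*gcd[m,n]≡gcd[cm,cn]; module Bézout)
  open import Data.Nat.Induction using (<-wellFounded; Acc; acc)
  open import Data.Nat.ListAction using (sum; product)
  open import Data.Nat.Primality using (Prime; prime?; euclidsLemma; prime⇒nonZero; prime⇒irreducible; ¬prime[1]; productOfPrimes≢0)
  open import Data.Nat.Primality.Factorisation using (factorise; PrimeFactorisation)
  import Data.Nat.Properties as ℕ
  import Data.Nat.Tactic.RingSolver as ℕSolver
  open import Data.Product using (Σ; ∃; ∃₂; _×_; _,_; proj₁; proj₂)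
  import Data.Product.Function.Dependent.Propositional as Σ
  open import Data.Product.Function.NonDependent.Propositional using (_×-↔_)
  open import Data.Product.Properties using (≡-dec)
  open import Data.Sum as Sum using (_⊎_; inj₁; inj₂; [_,_]′)
  open import Data.Sum.Function.Propositional using (_⊎-↔_)
  open import Data.Unit using (⊤; tt)
  open import Function.Base using (_∘_; it)
  open import Function.Bundles using (_↔_; mk⇔; mk↔ₛ′; Inverse; Injection)
  open import Function.Properties.Inverse using (↔-refl; ↔-sym; ↔-trans; ↔⇒↣)
  open import Relation.Binary.Definitions using (DecidableEquality)
  open import Relation.Binary.PropositionalEquality
  open import Relation.Binary.PropositionalEquality.WithK using (≡-irrelevant)
  open import Relation.Nullary using (¬_; Dec; yes; no)
  open import Relation.Nullary.Decidable using (toWitness; map′; ¬?)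

  -- Divisibility in ℤ, residues and Bézout coefficients

  infix 4 _∣ℕ_
  _∣ℕ_ : ℕ → ℕ → Set
  _∣ℕ_ = ℕ∣._∣_

  ∣-comb₁ : ∀ {k u z} → k ∣ u → ∀ a → z ≡ a * u → k ∣ z
  ∣-comb₁ h a refl = ℤ∣.∣n⇒∣m*n a h

  ∣-comb₂ : ∀ {k u v z} → k ∣ u → k ∣ v → ∀ a b → z ≡ a * u + b * v → k ∣ z
  ∣-comb₂ h i a b refl = ℤ∣.∣m∣n⇒∣m+n (ℤ∣.∣n⇒∣m*n a h) (ℤ∣.∣n⇒∣m*n b i)

  ∣-comb₃ : ∀ {k u v w z} → k ∣ u → k ∣ v → k ∣ w → ∀ a b c → z ≡ a * u + b * v + c * w → k ∣ z
  ∣-comb₃ h i j a b c refl = ℤ∣.∣m∣n⇒∣m+n (∣-comb₂ h i a b refl) (ℤ∣.∣n⇒∣m*n c j)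

  *-pres-∣ : ∀ {k m u v} → k ∣ u → m ∣ v → k * m ∣ u * v
  *-pres-∣ {k} {m = m} (divides q refl) (divides r refl) = divides (q * r) (eq q k r m)
    where
    eq : ∀ q k r m → q * k * (r * m) ≡ q * r * (k * m)
    eq = solve-∀

  +∣+⇒∣ : ∀ {a b} → + a ∣ + b → a ∣ℕ b
  +∣+⇒∣ h = ℤ∣.∣⇒∣ᵤ h

  ∣⇒+∣+ : ∀ {a b} → a ∣ℕ b → + a ∣ + b
  ∣⇒+∣+ {a} {b} h = ℤ∣.∣ᵤ⇒∣ {+ a} {+ b} h

  ⟦_⟧ : ∀ {n} → Fin n → ℤ
  ⟦ i ⟧ = + toℕ i

  module _ (n : ℕ) .{{_ : ℕ.NonZero n}} where

    abstract
      residue : ℤ → Fin n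
      residue x = fromℕ< (n%ℕd<d x n)

      residue-≡ : ∀ x → + n ∣ ⟦ residue x ⟧ - x
      residue-≡ x = divides (- (x /ℕ n)) (begin
        ⟦ residue x ⟧ - x                                ≡⟨ cong (λ r → + r - x) (Fin.toℕ-fromℕ< (n%ℕd<d x n)) ⟩
        + (x %ℕ n) - x                                   ≡⟨ cong (λ y → + (x %ℕ n) - y) (a≡a%ℕn+[a/ℕn]*n x n) ⟩
        + (x %ℕ n) - (+ (x %ℕ n) + (x /ℕ n) * + n)       ≡⟨ eq (+ (x %ℕ n)) (x /ℕ n) (+ n) ⟩
        - (x /ℕ n) * + n ∎)
        where
        open ≡-Reasoning
        eq : ∀ r q n → r - (r + q * n) ≡ - q * n
        eq = solve-∀

  ∣-bounded⇒≡0 : ∀ {k x} → x ℕ.< k → k ∣ℕ x → x ≡ 0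
  ∣-bounded⇒≡0 {x = zero}  _ _ = refl
  ∣-bounded⇒≡0 {x = suc _} l h = ⊥-elim (ℕ.<⇒≱ l (ℕ∣.∣⇒≤ h))

  +-injective-mod : ∀ {n x y} → x ℕ.< n → y ℕ.< n → + n ∣ + x - + y → x ≡ y
  +-injective-mod {n} {x} {y} x<n y<n h =
    [ (λ x≤y → go x≤y y<n h) ,
      (λ y≤x → sym (go y≤x x<n (∣-comb₁ h (- 1ℤ) (neg (+ x) (+ y))))) ]′
    (ℕ.≤-total x y)
    where
    neg : ∀ a b → b - a ≡ - 1ℤ * (a - b)
    neg = solve-∀
    go : ∀ {x y} → x ℕ.≤ y → y ℕ.< n → + n ∣ + x - + y → x ≡ y
    go {x} {y} x≤y y<n h = ℕ.≤-antisym x≤y (ℕ.m∸n≡0⇒m≤n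
      (∣-bounded⇒≡0 (ℕ.≤-<-trans (ℕ.m∸n≤m y x) y<n) (+∣+⇒∣ (subst (+ n ∣_) eq (ℤ∣.∣m⇒∣-m h)))))
      where
      neg′ : ∀ a b → - (a - b) ≡ b - a
      neg′ = solve-∀
      eq : - (+ x - + y) ≡ + (y ℕ.∸ x)
      eq = trans (neg′ (+ x) (+ y)) (trans (ℤ.m-n≡m⊖n y x) (ℤ.⊖-≥ x≤y))

  abstract
    ⟦⟧-injective-mod : ∀ {n} {i j : Fin n} → + n ∣ ⟦ i ⟧ - ⟦ j ⟧ → i ≡ j
    ⟦⟧-injective-mod {i = i} {j} h = Fin.toℕ-injective (+-injective-mod (Fin.toℕ<n i) (Fin.toℕ<n j) h)

  Bézoutℤ : ℤ → ℤ → Set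
  Bézoutℤ x y = ∃₂ λ s t → s * x + t * y ≡ 1ℤ

  abstract
    coprime⇒Bézoutℤ : ∀ {x y} → Coprime x y → Bézoutℤ (+ x) (+ y)
    coprime⇒Bézoutℤ {x} {y} c with coprime-Bézout c
    ... | Bézout.+- s t eq = + s , - + t , (begin
      + s * + x + - + t * + y     ≡⟨ cong (λ q → q + - + t * + y)
                                      (trans (sym (ℤ.pos-* s x)) (trans (cong +_ (sym eq)) (cong (λ q → 1ℤ + q) (ℤ.pos-* t y)))) ⟩
      1ℤ + + t * + y + - + t * + y ≡⟨ cancel (+ t) (+ y) ⟩
      1ℤ ∎)
      where
      open ≡-Reasoning
      cancel : ∀ t y → 1ℤ + t * y + - t * y ≡ 1ℤ
      cancel = solve-∀
    ... | Bézout.-+ s t eq = - + s , + t , (begin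
      - + s * + x + + t * + y     ≡⟨ cong (λ q → - + s * + x + q)
                                      (trans (sym (ℤ.pos-* t y)) (trans (cong +_ (sym eq)) (cong (λ q → 1ℤ + q) (ℤ.pos-* s x)))) ⟩
      - + s * + x + (1ℤ + + s * + x) ≡⟨ cancel (+ s) (+ x) ⟩
      1ℤ ∎)
      where
      open ≡-Reasoning
      cancel : ∀ s x → - s * x + (1ℤ + s * x) ≡ 1ℤ
      cancel = solve-∀

  -- The finite set of roots of f modulo k

  f : ℤ → ℤ
  f x = x * x + + 3 * x + 1ℤ

  Root : ℕ → Set
  Root k = Σ (Fin k) λ i → + k ∣ f ⟦ i ⟧

  -- Cancelling k ≠ 0 determines the quotient. A root is therefore determined by its residue, and
  -- `Root k` is a set of residues that can be counted.
  ∣-irrelevant : ∀ {k} {x : ℤ} .{{_ : ℕ.NonZero k}} (p q : + k ∣ x) → p ≡ q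
  ∣-irrelevant {suc k} (divides q₁ e₁) (divides q₂ e₂)
    with ℤ.*-cancelʳ-≡ q₁ q₂ (+ suc k) (trans (sym e₁) e₂)
  ... | refl = cong (divides q₁) (≡-irrelevant e₁ e₂)

  Root-≡ : ∀ {k} .{{_ : ℕ.NonZero k}} {r s : Root k} → + k ∣ ⟦ proj₁ r ⟧ - ⟦ proj₁ s ⟧ → r ≡ s
  Root-≡ {r = i , p} {j , q} h with ⟦⟧-injective-mod {i = i} {j} h
  ... | refl = cong (i ,_) (∣-irrelevant p q)

  f-cong : ∀ {k} x y → k ∣ x - y → k ∣ f y → k ∣ f x
  f-cong x y h i = ∣-comb₂ h i (x + y + + 3) 1ℤ (eq x y)
    where
    eq : ∀ x y → x * x + + 3 * x + 1ℤ ≡ (x + y + + 3) * (x - y) + 1ℤ * (y * y + + 3 * y + 1ℤ)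
    eq = solve-∀

  toRoot : ∀ k .{{_ : ℕ.NonZero k}} x → + k ∣ f x → Root k
  toRoot k x h = residue k x , f-cong ⟦ residue k x ⟧ x (residue-≡ k x) h

  -- Lifting and gluing roots

  ≡⇒∣- : ∀ {k u v} → u ≡ v → k ∣ u - v
  ≡⇒∣- {u = u} refl = divides 0ℤ (ℤ.+-inverseʳ u)

  *-∣ʳ : ∀ m n {x} → + m * + n ∣ x → + (m ℕ.* n) ∣ x
  *-∣ʳ m n = subst (_∣ _) (sym (ℤ.pos-* m n))

  *-∣⇒∣ˡ : ∀ m n {x} → + (m ℕ.* n) ∣ x → + m ∣ x
  *-∣⇒∣ˡ m n = ℤ∣.∣-trans (∣⇒+∣+ (ℕ∣.m∣m*n n))

  *-∣⇒∣ʳ : ∀ m n {x} → + (m ℕ.* n) ∣ x → + n ∣ x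
  *-∣⇒∣ʳ m n = ℤ∣.∣-trans (∣⇒+∣+ (ℕ∣.n∣m*n m))

  ∣-trans-mod : ∀ {k} x y z → k ∣ x - y → k ∣ y - z → k ∣ x - z
  ∣-trans-mod x y z h i = ∣-comb₂ h i 1ℤ 1ℤ (eq x y z)
    where
    eq : ∀ x y z → x - z ≡ 1ℤ * (x - y) + 1ℤ * (y - z)
    eq = solve-∀

  -- Multiplying `s * m + t * n ≡ 1` by x writes x as a sum of two multiples of `m * n`.
  Bézout⇒*-∣ : ∀ {m n x} → Bézoutℤ m n → m ∣ x → n ∣ x → m * n ∣ x
  Bézout⇒*-∣ {m} {n} {x} (s , t , e) m∣x n∣x =
    ∣-comb₃ (*-pres-∣ (ℤ∣.∣-refl {m}) n∣x) (*-pres-∣ m∣x (ℤ∣.∣-refl {n})) (≡⇒∣- e) s t (- x) (eq s t m n x)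
    where
    eq : ∀ s t m n x → x ≡ s * (m * x) + t * (x * n) + - x * (s * m + t * n - 1ℤ)
    eq = solve-∀

  -- Chinese remainder theorem: `s * m` is 0 modulo m and 1 modulo n, and `t * n` the other way
  -- round, so `lift a b` reduces to a and to b.
  Root-* : ∀ m n .{{_ : ℕ.NonZero m}} .{{_ : ℕ.NonZero n}} → Coprime m n → Root (m ℕ.* n) ↔ (Root m × Root n)
  Root-* m n c = mk↔ₛ′ to from
    (λ (a , b) → cong₂ _,_ (Root-≡ (to-from₁ a b)) (Root-≡ (to-from₂ a b)))
    (λ r → Root-≡ {r = from (to r)} {r} (*-∣ʳ m n (Bézout⇒*-∣ bez (from-to₁ r) (from-to₂ r))))
    where
    instance _ = ℕ.m*n≢0 m n
    bez = coprime⇒Bézoutℤ c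
    s = proj₁ bez
    t = proj₁ (proj₂ bez)
    st : s * + m + t * + n ≡ 1ℤ
    st = proj₂ (proj₂ bez)
    lift : ℤ → ℤ → ℤ
    lift a b = s * + m * b + t * + n * a
    lift₁ : ∀ a b → + m ∣ lift a b - a
    lift₁ a b = ∣-comb₂ (ℤ∣.∣-refl {+ m}) (≡⇒∣- st) (s * (b - a)) a (eq s t (+ m) (+ n) a b)
      where
      eq : ∀ s t m n a b → s * m * b + t * n * a - a ≡ s * (b - a) * m + a * (s * m + t * n - 1ℤ)
      eq = solve-∀
    lift₂ : ∀ a b → + n ∣ lift a b - b
    lift₂ a b = ∣-comb₂ (ℤ∣.∣-refl {+ n}) (≡⇒∣- st) (t * (a - b)) b (eq s t (+ m) (+ n) a b)
      where
      eq : ∀ s t m n a b → s * m * b + t * n * a - b ≡ t * (a - b) * n + b * (s * m + t * n - 1ℤ)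
      eq = solve-∀
    to : Root (m ℕ.* n) → Root m × Root n
    to (i , h) = toRoot m ⟦ i ⟧ (*-∣⇒∣ˡ m n h) , toRoot n ⟦ i ⟧ (*-∣⇒∣ʳ m n h)
    from : Root m × Root n → Root (m ℕ.* n)
    from ((a , ha) , (b , hb)) = toRoot (m ℕ.* n) (lift ⟦ a ⟧ ⟦ b ⟧)
      (*-∣ʳ m n (Bézout⇒*-∣ bez (f-cong (lift ⟦ a ⟧ ⟦ b ⟧) ⟦ a ⟧ (lift₁ ⟦ a ⟧ ⟦ b ⟧) ha)
        (f-cong (lift ⟦ a ⟧ ⟦ b ⟧) ⟦ b ⟧ (lift₂ ⟦ a ⟧ ⟦ b ⟧) hb)))
    module _ (a : Root m) (b : Root n) where
      x = lift ⟦ proj₁ a ⟧ ⟦ proj₁ b ⟧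
      y = ⟦ residue (m ℕ.* n) x ⟧
      to-from₁ : + m ∣ ⟦ residue m y ⟧ - ⟦ proj₁ a ⟧
      to-from₁ = ∣-trans-mod ⟦ residue m y ⟧ y ⟦ proj₁ a ⟧ (residue-≡ m y)
        (∣-trans-mod y x ⟦ proj₁ a ⟧ (*-∣⇒∣ˡ m n (residue-≡ (m ℕ.* n) x)) (lift₁ ⟦ proj₁ a ⟧ ⟦ proj₁ b ⟧))
      to-from₂ : + n ∣ ⟦ residue n y ⟧ - ⟦ proj₁ b ⟧
      to-from₂ = ∣-trans-mod ⟦ residue n y ⟧ y ⟦ proj₁ b ⟧ (residue-≡ n y)
        (∣-trans-mod y x ⟦ proj₁ b ⟧ (*-∣⇒∣ʳ m n (residue-≡ (m ℕ.* n) x)) (lift₂ ⟦ proj₁ a ⟧ ⟦ proj₁ b ⟧))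
    module _ (r : Root (m ℕ.* n)) where
      i = ⟦ proj₁ r ⟧
      a = ⟦ residue m i ⟧
      b = ⟦ residue n i ⟧
      x′ = ⟦ residue (m ℕ.* n) (lift a b) ⟧
      from-to₁ : + m ∣ x′ - i
      from-to₁ = ∣-trans-mod x′ (lift a b) i (*-∣⇒∣ˡ m n (residue-≡ (m ℕ.* n) (lift a b)))
        (∣-trans-mod (lift a b) a i (lift₁ a b) (residue-≡ m i))
      from-to₂ : + n ∣ x′ - i
      from-to₂ = ∣-trans-mod x′ (lift a b) i (*-∣⇒∣ʳ m n (residue-≡ (m ℕ.* n) (lift a b)))
        (∣-trans-mod (lift a b) b i (lift₂ a b) (residue-≡ n i))

  -- Newton's step x ↦ x - f(x) f′(x)⁻¹: f′(x)² = 4 f(x) + 5, so f′(x) / 5 serves as the inverse.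
  Root-lift : ∀ p k .{{_ : ℕ.NonZero p}} .{{_ : ℕ.NonZero k}} → Coprime p 5 → p ∣ℕ k →
              Root (p ℕ.* k) ↔ Root k
  Root-lift p k c p∣k = mk↔ₛ′ to from
    (λ r → Root-≡ {r = to (from r)} {r} (to-from r))
    (λ r → Root-≡ {r = from (to r)} {r} (from-to r))
    where
    instance _ = ℕ.m*n≢0 p k
    bez = coprime⇒Bézoutℤ c
    t = proj₁ bez
    e = proj₁ (proj₂ bez)
    te : t * + p + e * + 5 ≡ 1ℤ
    te = proj₂ (proj₂ bez)
    p∣+k : + p ∣ + k
    p∣+k = ∣⇒+∣+ p∣k
    pk∣p* : ∀ {x} → + k ∣ x → + (p ℕ.* k) ∣ + p * x
    pk∣p* h = *-∣ʳ p k (*-pres-∣ (ℤ∣.∣-refl {+ p}) h)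
    pk∣* : ∀ {x y} → + k ∣ x → + k ∣ y → + (p ℕ.* k) ∣ x * y
    pk∣* h i = *-∣ʳ p k (*-pres-∣ (ℤ∣.∣-trans p∣+k h) i)
    newton : ℤ → ℤ
    newton x = x - e * (+ 2 * x + + 3) * f x
    -- As `e` inverts 5 only modulo p, a linear term t p f(x) survives; it is divisible by p k
    -- because k ∣ f(x). The terms in f(x)² vanish because p ∣ k makes k² a multiple of p k.
    newton-root : ∀ x → + k ∣ f x → + (p ℕ.* k) ∣ f (newton x)
    newton-root x h = ∣-comb₃ (pk∣p* h) (pk∣* h h) (≡⇒∣- te)
      t (e * e * (+ 2 * x + + 3) * (+ 2 * x + + 3) - + 4 * e) (- f x) (eq t e (+ p) x)
      where
      eq : ∀ t e p x → let y = x * x + + 3 * x + 1ℤ ; n = x - e * (+ 2 * x + + 3) * y in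
        n * n + + 3 * n + 1ℤ ≡
        t * (p * y) + (e * e * (+ 2 * x + + 3) * (+ 2 * x + + 3) - + 4 * e) * (y * y)
          + - y * (t * p + e * + 5 - 1ℤ)
      eq = solve-∀
    newton-≡ : ∀ x → + k ∣ f x → + k ∣ newton x - x
    newton-≡ x h = ∣-comb₁ h (- (e * (+ 2 * x + + 3))) (eq e x (f x))
      where
      eq : ∀ e x y → x - e * (+ 2 * x + + 3) * y - x ≡ - (e * (+ 2 * x + + 3)) * y
      eq = solve-∀
    -- f(x) - f(y) equals (x - y)(2 x + 3) - (x - y)², where the square is already 0 modulo p k.
    -- Multiplying by e (2 x + 3) isolates x - y up to t p (x - y), again a multiple of p k.
    unique : ∀ x y → + (p ℕ.* k) ∣ f x → + (p ℕ.* k) ∣ f y → + k ∣ x - y → + (p ℕ.* k) ∣ x - y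
    unique x y hx hy h = ∣-comb₃ (pk∣p* h) (pk∣* h h)
      (∣-comb₃ hx hy (≡⇒∣- te) (e * (+ 2 * x + + 3) - + 4 * e * (x - y)) (- (e * (+ 2 * x + + 3))) (- (x - y)) refl)
      t (e * (+ 2 * x + + 3)) 1ℤ (eq t e (+ p) x y)
      where
      eq : ∀ t e p x y → x - y ≡ t * (p * (x - y)) + e * (+ 2 * x + + 3) * ((x - y) * (x - y))
        + 1ℤ * ((e * (+ 2 * x + + 3) - + 4 * e * (x - y)) * (x * x + + 3 * x + 1ℤ)
                + - (e * (+ 2 * x + + 3)) * (y * y + + 3 * y + 1ℤ) + - (x - y) * (t * p + e * + 5 - 1ℤ))
      eq = solve-∀
    to : Root (p ℕ.* k) → Root k
    to (i , h) = toRoot k ⟦ i ⟧ (*-∣⇒∣ʳ p k h)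
    from : Root k → Root (p ℕ.* k)
    from (i , h) = toRoot (p ℕ.* k) (newton ⟦ i ⟧) (newton-root ⟦ i ⟧ h)
    to-from : ∀ r → + k ∣ ⟦ proj₁ (to (from r)) ⟧ - ⟦ proj₁ r ⟧
    to-from (i , h) = ∣-trans-mod ⟦ residue k y ⟧ y ⟦ i ⟧ (residue-≡ k y)
      (∣-trans-mod y (newton ⟦ i ⟧) ⟦ i ⟧ (*-∣⇒∣ʳ p k (residue-≡ (p ℕ.* k) (newton ⟦ i ⟧))) (newton-≡ ⟦ i ⟧ h))
      where y = ⟦ residue (p ℕ.* k) (newton ⟦ i ⟧) ⟧
    from-to : ∀ r → + (p ℕ.* k) ∣ ⟦ proj₁ (from (to r)) ⟧ - ⟦ proj₁ r ⟧
    from-to r@(i , h) = unique ⟦ proj₁ (from (to r)) ⟧ ⟦ i ⟧ (proj₂ (from (to r))) h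
      (∣-trans-mod ⟦ proj₁ (from (to r)) ⟧ (newton y) ⟦ i ⟧ (*-∣⇒∣ʳ p k (residue-≡ (p ℕ.* k) (newton y)))
        (∣-trans-mod (newton y) y ⟦ i ⟧ (newton-≡ y (proj₂ (to r))) (residue-≡ k ⟦ i ⟧)))
      where y = ⟦ residue k ⟦ i ⟧ ⟧

  -- Roots modulo 5, 25 and the other primes

  euclidsLemmaℤ : ∀ {p} → Prime p → ∀ x y → + p ∣ x * y → + p ∣ x ⊎ + p ∣ y
  euclidsLemmaℤ {p} pp x y h
    with euclidsLemma ℤ.∣ x ∣ ℤ.∣ y ∣ pp (subst (p ∣ℕ_) (ℤ.abs-* x y) (ℤ∣.∣⇒∣ᵤ h))
  ... | inj₁ i = inj₁ (ℤ∣.∣ᵤ⇒∣ i)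
  ... | inj₂ j = inj₂ (ℤ∣.∣ᵤ⇒∣ j)

  ↔Fin1 : ∀ {A : Set} (a : A) → (∀ x → x ≡ a) → A ↔ Fin 1
  ↔Fin1 a eq = mk↔ₛ′ (λ _ → Fin.zero) (λ _ → a) (λ { Fin.zero → refl ; (Fin.suc ()) }) (λ x → sym (eq x))

  ↔Fin2 : ∀ {A : Set} (a b : A) → a ≢ b → (∀ x → x ≡ a ⊎ x ≡ b) → A ↔ Fin 2
  ↔Fin2 {A} a b a≢b cover = mk↔ₛ′ to from to-from from-to
    where
    fromPair : ∀ x → x ≡ a ⊎ x ≡ b → Fin 2
    fromPair _ (inj₁ _) = Fin.zero
    fromPair _ (inj₂ _) = Fin.suc Fin.zero
    to : A → Fin 2
    to x = fromPair x (cover x)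
    from : Fin 2 → A
    from Fin.zero    = a
    from (Fin.suc _) = b
    to-from : ∀ i → to (from i) ≡ i
    to-from Fin.zero with cover a
    ... | inj₁ _  = refl
    ... | inj₂ eq = ⊥-elim (a≢b eq)
    to-from (Fin.suc Fin.zero) with cover b
    ... | inj₁ eq = ⊥-elim (a≢b (sym eq))
    ... | inj₂ _  = refl
    from-to : ∀ x → from (to x) ≡ x
    from-to x with cover x
    ... | inj₁ eq = sym eq
    ... | inj₂ eq = sym eq

  prime[5] : Prime 5
  prime[5] = toWitness {a? = prime? 5} _

  prime-∤5 : ∀ {p} → Prime p → p ≢ 5 → ¬ + p ∣ + 5
  prime-∤5 pp p≢5 h with prime⇒irreducible prime[5] (+∣+⇒∣ h)
  ... | inj₁ refl = ¬prime[1] pp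
  ... | inj₂ eq   = p≢5 eq

  -- By Vieta the second root is -3 - x. The two coincide only if p divides 2 x + 3, and then p
  -- divides the discriminant 5 = (2 x + 3)² - 4 f(x).
  Root-prime : ∀ {p} → Prime p → p ≢ 5 → Root p → Root p ↔ Fin 2
  Root-prime {p} pp p≢5 r@(i , h) = ↔Fin2 r s r≢s cover
    where
    instance _ = prime⇒nonZero pp
    x = ⟦ i ⟧
    s : Root p
    s = toRoot p (- + 3 - x) (∣-comb₁ h 1ℤ (eq x))
      where
      eq : ∀ x → (- + 3 - x) * (- + 3 - x) + + 3 * (- + 3 - x) + 1ℤ ≡ 1ℤ * (x * x + + 3 * x + 1ℤ)
      eq = solve-∀
    r≢s : r ≢ s
    r≢s r≡s = prime-∤5 pp p≢5 (∣-comb₂ 2x+3 h (+ 2 * x + + 3) (- + 4) (eq x))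
      where
      eq₂ : ∀ x → + 2 * x + + 3 ≡ 1ℤ * (x - (- + 3 - x))
      eq₂ = solve-∀
      2x+3 : + p ∣ + 2 * x + + 3
      2x+3 = ∣-comb₁ (subst (λ z → + p ∣ z - (- + 3 - x)) (cong (λ r → ⟦ proj₁ r ⟧) (sym r≡s)) (residue-≡ p (- + 3 - x))) 1ℤ (eq₂ x)
      eq : ∀ x → + 5 ≡ (+ 2 * x + + 3) * (+ 2 * x + + 3) + - + 4 * (x * x + + 3 * x + 1ℤ)
      eq = solve-∀
    cover : ∀ t → t ≡ r ⊎ t ≡ s
    cover t@(j , g) = Sum.map
      (λ a → Root-≡ {r = t} {r} a)
      (λ b → Root-≡ {r = t} {s} (∣-comb₂ b (residue-≡ p (- + 3 - x)) 1ℤ (- 1ℤ) (eq₁ ⟦ j ⟧ x ⟦ proj₁ s ⟧)))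
      (euclidsLemmaℤ pp (⟦ j ⟧ - x) (⟦ j ⟧ + x + + 3) (∣-comb₂ g h 1ℤ (- 1ℤ) (eq₂ ⟦ j ⟧ x)))
      where
      eq₁ : ∀ y x z → y - z ≡ 1ℤ * (y + x + + 3) + - 1ℤ * (z - (- + 3 - x))
      eq₁ = solve-∀
      eq₂ : ∀ y x → (y - x) * (y + x + + 3) ≡ 1ℤ * (y * y + + 3 * y + 1ℤ) + - 1ℤ * (x * x + + 3 * x + 1ℤ)
      eq₂ = solve-∀

  -- f(x) = (x - 1)² + 5 x, so 1 is a double root modulo 5.
  5∣f⇒ : ∀ x → + 5 ∣ f x → + 5 ∣ x - 1ℤ
  5∣f⇒ x h = Sum.reduce (euclidsLemmaℤ prime[5] (x - 1ℤ) (x - 1ℤ) (∣-comb₂ h (ℤ∣.∣-refl {+ 5}) 1ℤ (- x) (eq x)))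
    where
    eq : ∀ x → (x - 1ℤ) * (x - 1ℤ) ≡ 1ℤ * (x * x + + 3 * x + 1ℤ) + - x * + 5
    eq = solve-∀

  Root-5 : Root 5 ↔ Fin 1
  Root-5 = ↔Fin1 (Fin.suc Fin.zero , divides 1ℤ refl) (λ r → Root-≡ (5∣f⇒ ⟦ proj₁ r ⟧ (proj₂ r)))

  -- The double root does not lift: f(x) = (x - 1)² + 5 (x - 1) + 5, which is 5 modulo 25 once 5 ∣ x
  -- - 1.
  25∤f : ∀ x → ¬ + 25 ∣ f x
  25∤f x h = absurd (∣-comb₃ h (*-pres-∣ d d) (*-pres-∣ (ℤ∣.∣-refl {+ 5}) d) 1ℤ (- 1ℤ) (- 1ℤ) (eq x))
    where
    d : + 5 ∣ x - 1ℤ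
    d = 5∣f⇒ x (ℤ∣.∣-trans (∣⇒+∣+ (ℕ∣.m∣m*n {5} 5)) h)
    absurd : ¬ + 25 ∣ + 5
    absurd h = ℕ.<⇒≱ (toWitness {a? = 5 ℕ.<? 25} _) (ℕ∣.∣⇒≤ (+∣+⇒∣ h))
    eq : ∀ x → + 5 ≡ 1ℤ * (x * x + + 3 * x + 1ℤ) + - 1ℤ * ((x - 1ℤ) * (x - 1ℤ)) + - 1ℤ * (+ 5 * (x - 1ℤ))
    eq = solve-∀

  -- Existence of roots modulo a prime p ≡ ±1 (mod 5)

  module _ {A : Set} where

    ⊆-antisym⇒length≡ : {xs ys : List A} → Unique xs → Unique ys →
      (∀ {x} → x ∈ xs → x ∈ ys) → (∀ {x} → x ∈ ys → x ∈ xs) → length xs ≡ length ys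
    ⊆-antisym⇒length≡ u v i j = ↭-length (∼bag⇒↭ (unique∧set⇒bag u v (mk⇔ i j)))

    module _ (_≟_ : DecidableEquality A) (σ : A → A)
             (σ⁵≗id : ∀ a → σ (σ (σ (σ (σ a)))) ≡ a) (noFix : ∀ a → σ a ≢ a) where

      open import Data.List.Membership.DecPropositional _≟_ using (_∈?_)

      private
        orbit : A → List A
        orbit a = a ∷ σ a ∷ σ (σ a) ∷ σ (σ (σ a)) ∷ σ (σ (σ (σ a))) ∷ []

        -- As 5 is prime, every nontrivial power of σ generates the same cyclic group as σ: a point
        -- fixed by σ² is fixed by σ⁴, hence by σ. So every orbit has exactly five elements.
        σ²≢ : ∀ a → σ (σ a) ≢ a
        σ²≢ a e = noFix a (trans (cong σ (sym (trans (cong (σ ∘ σ) e) e))) (σ⁵≗id a))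

        σ-injective : ∀ {a b} → σ a ≡ σ b → a ≡ b
        σ-injective {a} {b} e = trans (sym (σ⁵≗id a)) (trans (cong (σ ∘ σ ∘ σ ∘ σ) e) (σ⁵≗id b))

        σ³≢ : ∀ a → σ (σ (σ a)) ≢ a
        σ³≢ a e = σ²≢ a (trans (cong (σ ∘ σ) (sym e)) (σ⁵≗id a))

        σ⁴≢ : ∀ a → σ (σ (σ (σ a))) ≢ a
        σ⁴≢ a e = noFix a (trans (cong σ (sym e)) (σ⁵≗id a))

        orbit-unique : ∀ a → Unique (orbit a)
        orbit-unique a = (≢-sym (noFix a) ∷ ≢-sym (σ²≢ a) ∷ ≢-sym (σ³≢ a) ∷ ≢-sym (σ⁴≢ a) ∷ [])
          ∷ (≢-sym (noFix _) ∷ ≢-sym (σ²≢ _) ∷ ≢-sym (σ³≢ _) ∷ [])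
          ∷ (≢-sym (noFix _) ∷ ≢-sym (σ²≢ _) ∷ [])
          ∷ (≢-sym (noFix _) ∷ []) ∷ [] ∷ []

        orbit-⊆ : ∀ {a L} → (∀ {x} → x ∈ L → σ x ∈ L) → a ∈ L → ∀ {x} → x ∈ orbit a → x ∈ L
        orbit-⊆ cl h (here refl) = h
        orbit-⊆ cl h (there (here refl)) = cl h
        orbit-⊆ cl h (there (there (here refl))) = cl (cl h)
        orbit-⊆ cl h (there (there (there (here refl)))) = cl (cl (cl h))
        orbit-⊆ cl h (there (there (there (there (here refl))))) = cl (cl (cl (cl h)))

        orbit-σ⁻¹ : ∀ {a x} → σ x ∈ orbit a → x ∈ orbit a
        orbit-σ⁻¹ {a} (here e) = there (there (there (there (here (σ-injective (trans e (sym (σ⁵≗id a))))))))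
        orbit-σ⁻¹ (there (here e)) = here (σ-injective e)
        orbit-σ⁻¹ (there (there (here e))) = there (here (σ-injective e))
        orbit-σ⁻¹ (there (there (there (here e)))) = there (there (here (σ-injective e)))
        orbit-σ⁻¹ (there (there (there (there (here e))))) = there (there (there (here (σ-injective e))))

        -- Orbits are split off one at a time. The remainder stays closed under σ because, by
        -- `orbit-σ⁻¹`, no element outside the orbit is mapped into it.
        5∣length′ : ∀ L → Acc ℕ._<_ (length L) → Unique L → (∀ {x} → x ∈ L → σ x ∈ L) → 5 ∣ℕ length L
        5∣length′ [] _ _ _ = 5 ℕ∣.∣0
        5∣length′ L@(a ∷ _) (acc rec) u cl = subst (5 ∣ℕ_) (sym len)
          (ℕ∣.∣m∣n⇒∣m+n (ℕ∣.∣-refl {5}) (5∣length′ rest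
            (rec (subst (length rest ℕ.<_) (sym len) (ℕ.s≤s (ℕ.m≤n+m _ 4))))
            (Unique.filter⁺ outside? u) rest-cl))
          where
          outside? : ∀ x → Dec (x ∉ orbit a)
          outside? x = ¬? (x ∈? orbit a)
          rest = filter outside? L
          rest-cl : ∀ {x} → x ∈ rest → σ x ∈ rest
          rest-cl h with ∈-filter⁻ outside? h
          ... | i , o = ∈-filter⁺ outside? (cl i) (o ∘ orbit-σ⁻¹)
          split : ∀ {x} → x ∈ L → x ∈ orbit a ++ rest
          split {x} h with x ∈? orbit a
          ... | yes o = ∈-++⁺ˡ o
          ... | no ¬o = ∈-++⁺ʳ (orbit a) (∈-filter⁺ outside? h ¬o)
          unsplit : ∀ {x} → x ∈ orbit a ++ rest → x ∈ L
          unsplit h = [ orbit-⊆ cl (here refl) , proj₁ ∘ ∈-filter⁻ outside? ]′ (∈-++⁻ (orbit a) h)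
          len : length L ≡ 5 ℕ.+ length rest
          len = ⊆-antisym⇒length≡ u
            (Unique.++⁺ (orbit-unique a) (Unique.filter⁺ outside? u) (λ (i , j) → proj₂ (∈-filter⁻ outside? {xs = L} j) i))
            split unsplit

      5∣cardinality : ∀ {n} → Fin n ↔ A → 5 ∣ℕ n
      5∣cardinality {n} e = subst (5 ∣ℕ_) (trans (List.length-map to (allFin n)) (List.length-tabulate {n = n} _))
        (5∣length′ (List.map to (allFin n)) (<-wellFounded _)
          (Unique.map⁺ (Injection.injective (↔⇒↣ e)) (Unique.allFin⁺ n)) (λ _ → all _))
        where
        open Inverse e
        all : ∀ a → a ∈ List.map to (allFin n)
        all a = subst (_∈ List.map to (allFin n)) (strictlyInverseˡ a) (∈-map⁺ to (∈-allFin (from a)))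

  prime⇒coprime-∤ : ∀ {p n} → Prime p → ¬ p ∣ℕ n → Coprime p n
  prime⇒coprime-∤ pp p∤n (d∣p , d∣n) with prime⇒irreducible pp d∣p
  ... | inj₁ d≡1 = d≡1
  ... | inj₂ refl = ⊥-elim (p∤n d∣n)

  inverse-mod : ∀ {p} → Prime p → ∀ a → ¬ + p ∣ a → ∃ λ b → + p ∣ a * b - 1ℤ
  inverse-mod {p} pp a p∤a = t , ∣-comb₃ (residue-≡ p a) (ℤ∣.∣-refl {+ p}) (≡⇒∣- e) (- t) (- s) 1ℤ (eq a t ⟦ r ⟧ s (+ p))
    where
    instance _ = prime⇒nonZero pp
    r = residue p a
    p∤r : ¬ p ∣ℕ toℕ r
    p∤r h = p∤a (∣-comb₂ (residue-≡ p a) (∣⇒+∣+ h) (- 1ℤ) 1ℤ (eq′ a ⟦ r ⟧))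
      where
      eq′ : ∀ a r → a ≡ - 1ℤ * (r - a) + 1ℤ * r
      eq′ = solve-∀
    bez = coprime⇒Bézoutℤ (prime⇒coprime-∤ pp p∤r)
    s = proj₁ bez
    t = proj₁ (proj₂ bez)
    e : s * + p + t * ⟦ r ⟧ ≡ 1ℤ
    e = proj₂ (proj₂ bez)
    eq : ∀ a t r s p → a * t - 1ℤ ≡ - t * (r - a) + - s * p + 1ℤ * (s * p + t * r - 1ℤ)
    eq = solve-∀

  module Pentagon {p} (pp : Prime p) where

    private
      instance _ = prime⇒nonZero pp
      ⌊_⌋ : ℤ → Fin p
      ⌊_⌋ = residue p
      ⌊⌋≡ : ∀ x → + p ∣ ⟦ ⌊ x ⌋ ⟧ - x
      ⌊⌋≡ = residue-≡ p

    -- Entries of Coxeter's pentagonal frieze pattern over ℤ/p: x₁x₂ - 1 = x₄ and its cyclic shifts all follow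
    -- from one cubic equation, so rotating the indices gives a map of order 5.  Its fixed points satisfy
    -- x² - x - 1 = 0, that is, f (x - 2) = 0.
    Frieze : Set
    Frieze = Σ (Fin p × Fin p × Fin p) λ (x , y , z) → + p ∣ ⟦ x ⟧ * ⟦ y ⟧ * ⟦ z ⟧ - ⟦ x ⟧ - ⟦ z ⟧ - 1ℤ

    Frieze-≡ : ∀ {x y z x′ y′ z′ h h′} → + p ∣ ⟦ x ⟧ - ⟦ x′ ⟧ → + p ∣ ⟦ y ⟧ - ⟦ y′ ⟧ → + p ∣ ⟦ z ⟧ - ⟦ z′ ⟧ →
               _≡_ {A = Frieze} ((x , y , z) , h) ((x′ , y′ , z′) , h′)
    Frieze-≡ {x} {y} {z} {x′} {y′} {z′} {h} {h′} a b c
      with ⟦⟧-injective-mod {i = x} {x′} a | ⟦⟧-injective-mod {i = y} {y′} b | ⟦⟧-injective-mod {i = z} {z′} c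
    ... | refl | refl | refl = cong (_ ,_) (∣-irrelevant h h′)

    proj₁-injective : ∀ {s t : Frieze} → proj₁ s ≡ proj₁ t → s ≡ t
    proj₁-injective {_ , h} {_ , h′} refl = cong (_ ,_) (∣-irrelevant h h′)

    _≟_ : DecidableEquality Frieze
    s ≟ t = map′ proj₁-injective (cong proj₁) (≡-dec Fin._≟_ (≡-dec Fin._≟_ Fin._≟_) (proj₁ s) (proj₁ t))

    rotate : Frieze → Frieze
    rotate ((x , y , z) , h) = (y , z , ⌊ ⟦ x ⟧ * ⟦ y ⟧ - 1ℤ ⌋) ,
      ∣-comb₂ (⌊⌋≡ (⟦ x ⟧ * ⟦ y ⟧ - 1ℤ)) h (⟦ y ⟧ * ⟦ z ⟧ - 1ℤ) ⟦ y ⟧ (eq ⟦ x ⟧ ⟦ y ⟧ ⟦ z ⟧ ⟦ ⌊ ⟦ x ⟧ * ⟦ y ⟧ - 1ℤ ⌋ ⟧)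
      where
      eq : ∀ x y z w → y * z * w - y - w - 1ℤ ≡ (y * z - 1ℤ) * (w - (x * y - 1ℤ)) + y * (x * y * z - x - z - 1ℤ)
      eq = solve-∀

    rotate⁵ : ∀ s → rotate (rotate (rotate (rotate (rotate s)))) ≡ s
    rotate⁵ ((x₀ , y₀ , z₀) , h) = Frieze-≡ hx hy hz
      where
      x = ⟦ x₀ ⟧
      y = ⟦ y₀ ⟧
      z = ⟦ z₀ ⟧
      w = ⟦ ⌊ x * y - 1ℤ ⌋ ⟧
      v = ⟦ ⌊ y * z - 1ℤ ⌋ ⟧
      -- With w = x y - 1 and v = y z - 1, the relation x y z = x + z + 1 gives z w - 1 = x, w v - 1
      -- = y and v x - 1 = z modulo p.
      x′ = ⟦ ⌊ z * w - 1ℤ ⌋ ⟧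
      y′ = ⟦ ⌊ w * v - 1ℤ ⌋ ⟧
      z′ = ⟦ ⌊ v * x′ - 1ℤ ⌋ ⟧
      hx : + p ∣ x′ - x
      hx = ∣-comb₃ (⌊⌋≡ (z * w - 1ℤ)) (⌊⌋≡ (x * y - 1ℤ)) h 1ℤ z 1ℤ (eq x y z w x′)
        where
        eq : ∀ x y z w x′ → x′ - x ≡ 1ℤ * (x′ - (z * w - 1ℤ)) + z * (w - (x * y - 1ℤ)) + 1ℤ * (x * y * z - x - z - 1ℤ)
        eq = solve-∀
      hy : + p ∣ y′ - y
      hy = ∣-comb₂ (⌊⌋≡ (w * v - 1ℤ)) (∣-comb₃ (⌊⌋≡ (x * y - 1ℤ)) (⌊⌋≡ (y * z - 1ℤ)) h v (x * y - 1ℤ) y refl) 1ℤ 1ℤ (eq x y z w v y′)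
        where
        eq : ∀ x y z w v y′ → y′ - y ≡ 1ℤ * (y′ - (w * v - 1ℤ)) + 1ℤ * (v * (w - (x * y - 1ℤ))
          + (x * y - 1ℤ) * (v - (y * z - 1ℤ)) + y * (x * y * z - x - z - 1ℤ))
        eq = solve-∀
      hz : + p ∣ z′ - z
      hz = ∣-comb₂ (⌊⌋≡ (v * x′ - 1ℤ)) (∣-comb₃ (⌊⌋≡ (y * z - 1ℤ)) hx h x′ (y * z - 1ℤ) 1ℤ refl) 1ℤ 1ℤ (eq x y z v x′ z′)
        where
        eq : ∀ x y z v x′ z′ → z′ - z ≡ 1ℤ * (z′ - (v * x′ - 1ℤ)) + 1ℤ * (x′ * (v - (y * z - 1ℤ))
          + (y * z - 1ℤ) * (x′ - x) + 1ℤ * (x * y * z - x - z - 1ℤ))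
        eq = solve-∀

    fixed⇒root : ∀ s → rotate s ≡ s → Root p
    fixed⇒root ((x , y , z) , h) e = toRoot p (⟦ x ⟧ - + 2)
      (∣-comb₁ (subst (+ p ∣_) (cong₂ (λ a b → ⟦ a ⟧ - (⟦ x ⟧ * ⟦ b ⟧ - 1ℤ)) w≡x y≡x) (⌊⌋≡ (⟦ x ⟧ * ⟦ y ⟧ - 1ℤ)))
        (- 1ℤ) (eq ⟦ x ⟧))
      where
      y≡x : y ≡ x
      y≡x = cong (proj₁ ∘ proj₁) e
      w≡x : ⌊ ⟦ x ⟧ * ⟦ y ⟧ - 1ℤ ⌋ ≡ x
      w≡x = trans (cong (proj₂ ∘ proj₂ ∘ proj₁) e) (trans (cong (proj₁ ∘ proj₂ ∘ proj₁) e) y≡x)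
      eq : ∀ x → (x - + 2) * (x - + 2) + + 3 * (x - + 2) + 1ℤ ≡ - 1ℤ * (x - (x * x - 1ℤ))
      eq = solve-∀

    -- The triples with x y = 1; the remaining ones are the graph z = (x + 1) / (x y - 1).  The pairs with x y = 1
    -- parametrise the degenerate triples with z ≠ 0, and one extra point stands for z = 0.
    degenerate : Fin p → Frieze
    degenerate z = (⌊ - 1ℤ ⌋ , ⌊ - 1ℤ ⌋ , z) , ∣-comb₁ (⌊⌋≡ (- 1ℤ)) (⟦ z ⟧ * m - ⟦ z ⟧ - 1ℤ) (eq m ⟦ z ⟧)
      where
      m = ⟦ ⌊ - 1ℤ ⌋ ⟧
      eq : ∀ m z → m * m * z - m - z - 1ℤ ≡ (z * m - z - 1ℤ) * (m - - 1ℤ)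
      eq = solve-∀

    fromPair : ∀ x y → Dec (+ p ∣ ⟦ x ⟧ * ⟦ y ⟧ - 1ℤ) → Frieze
    fromPair x y (yes _) = degenerate x
    fromPair x y (no ¬h) = (x , y , ⌊ (⟦ x ⟧ + 1ℤ) * i ⌋) ,
      ∣-comb₂ (⌊⌋≡ ((⟦ x ⟧ + 1ℤ) * i)) (proj₂ inv) (⟦ x ⟧ * ⟦ y ⟧ - 1ℤ) (⟦ x ⟧ + 1ℤ)
        (eq ⟦ x ⟧ ⟦ y ⟧ i ⟦ ⌊ (⟦ x ⟧ + 1ℤ) * i ⌋ ⟧)
      where
      inv = inverse-mod pp (⟦ x ⟧ * ⟦ y ⟧ - 1ℤ) ¬h
      i = proj₁ inv
      eq : ∀ x y i z → x * y * z - x - z - 1ℤ ≡ (x * y - 1ℤ) * (z - (x + 1ℤ) * i) + (x + 1ℤ) * ((x * y - 1ℤ) * i - 1ℤ)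
      eq = solve-∀

    toPair : ∀ x y z → Dec (+ p ∣ ⟦ x ⟧ * ⟦ y ⟧ - 1ℤ) → Dec (+ p ∣ ⟦ z ⟧) → ⊤ ⊎ (Fin p × Fin p)
    toPair x y z (no _)  _       = inj₂ (x , y)
    toPair x y z (yes _) (yes _) = inj₁ tt
    toPair x y z (yes _) (no ¬h) = inj₂ (z , ⌊ proj₁ (inverse-mod pp ⟦ z ⟧ ¬h) ⌋)

    unit? : ∀ (x y : Fin p) → Dec (+ p ∣ ⟦ x ⟧ * ⟦ y ⟧ - 1ℤ)
    unit? x y = + p ℤ∣.∣? (⟦ x ⟧ * ⟦ y ⟧ - 1ℤ)

    zero? : ∀ (z : Fin p) → Dec (+ p ∣ ⟦ z ⟧)
    zero? z = + p ℤ∣.∣? ⟦ z ⟧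

    to : ⊤ ⊎ (Fin p × Fin p) → Frieze
    to (inj₁ _)       = degenerate ⌊ 0ℤ ⌋
    to (inj₂ (x , y)) = fromPair x y (unit? x y)

    from : Frieze → ⊤ ⊎ (Fin p × Fin p)
    from ((x , y , z) , _) = toPair x y z (unit? x y) (zero? z)

    ∣-self : ∀ (i : Fin p) → + p ∣ ⟦ i ⟧ - ⟦ i ⟧
    ∣-self i = ≡⇒∣- {u = ⟦ i ⟧} refl

    p∤1 : ¬ + p ∣ 1ℤ
    p∤1 h = ¬prime[1] (subst Prime (ℕ∣.∣1⇒≡1 (+∣+⇒∣ h)) pp)

    [-1]² : + p ∣ ⟦ ⌊ - 1ℤ ⌋ ⟧ * ⟦ ⌊ - 1ℤ ⌋ ⟧ - 1ℤ
    [-1]² = ∣-comb₁ (⌊⌋≡ (- 1ℤ)) (⟦ ⌊ - 1ℤ ⌋ ⟧ - 1ℤ) (eq ⟦ ⌊ - 1ℤ ⌋ ⟧)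
      where
      eq : ∀ m → m * m - 1ℤ ≡ (m - 1ℤ) * (m - - 1ℤ)
      eq = solve-∀

    from-to₁ : ∀ d d′ → toPair ⌊ - 1ℤ ⌋ ⌊ - 1ℤ ⌋ ⌊ 0ℤ ⌋ d d′ ≡ inj₁ tt
    from-to₁ (no ¬h) _        = ⊥-elim (¬h [-1]²)
    from-to₁ (yes _) (yes _)  = refl
    from-to₁ (yes _) (no p∤0) = ⊥-elim (p∤0 (∣-comb₁ (⌊⌋≡ 0ℤ) 1ℤ (eq ⟦ ⌊ 0ℤ ⌋ ⟧)))
      where
      eq : ∀ z → z ≡ 1ℤ * (z - 0ℤ)
      eq = solve-∀

    from-to₂ : ∀ x y → + p ∣ ⟦ x ⟧ * ⟦ y ⟧ - 1ℤ → ∀ d d′ → toPair ⌊ - 1ℤ ⌋ ⌊ - 1ℤ ⌋ x d d′ ≡ inj₂ (x , y)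
    from-to₂ x y h (no ¬h) _         = ⊥-elim (¬h [-1]²)
    from-to₂ x y h (yes _) (yes p∣x) = ⊥-elim (p∤1 (∣-comb₂ p∣x h ⟦ y ⟧ (- 1ℤ) (eq ⟦ x ⟧ ⟦ y ⟧)))
      where
      eq : ∀ x y → 1ℤ ≡ y * x + - 1ℤ * (x * y - 1ℤ)
      eq = solve-∀
    from-to₂ x y h (yes _) (no p∤x)  = cong (λ y → inj₂ (x , y)) (⟦⟧-injective-mod {i = ⌊ i ⌋} {y}
      (∣-comb₃ (⌊⌋≡ i) h (proj₂ inv) 1ℤ (- i) ⟦ y ⟧ (eq ⟦ x ⟧ ⟦ y ⟧ i ⟦ ⌊ i ⌋ ⟧)))
      where
      inv = inverse-mod pp ⟦ x ⟧ p∤x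
      i = proj₁ inv
      eq : ∀ x y i j → j - y ≡ 1ℤ * (j - i) + - i * (x * y - 1ℤ) + y * (x * i - 1ℤ)
      eq = solve-∀

    from-to₃ : ∀ x y (d : Dec (+ p ∣ ⟦ x ⟧ * ⟦ y ⟧ - 1ℤ)) → from (fromPair x y d) ≡ inj₂ (x , y)
    from-to₃ x y (yes h) = from-to₂ x y h (unit? ⌊ - 1ℤ ⌋ ⌊ - 1ℤ ⌋) (zero? x)
    from-to₃ x y (no ¬h) = lemma z (unit? x y) (zero? z)
      where
      z = proj₂ (proj₂ (proj₁ (fromPair x y (no ¬h))))
      lemma : ∀ z d d′ → toPair x y z d d′ ≡ inj₂ (x , y)
      lemma z (no _)  _ = refl
      lemma z (yes h) _ = ⊥-elim (¬h h)

    from-to : ∀ a → from (to a) ≡ a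
    from-to (inj₁ tt)      = from-to₁ (unit? ⌊ - 1ℤ ⌋ ⌊ - 1ℤ ⌋) (zero? ⌊ 0ℤ ⌋)
    from-to (inj₂ (x , y)) = from-to₃ x y (unit? x y)

    to-from₁ : ∀ x y z h → ¬ + p ∣ ⟦ x ⟧ * ⟦ y ⟧ - 1ℤ → ∀ d → fromPair x y d ≡ ((x , y , z) , h)
    to-from₁ x y z h ¬e (yes e) = ⊥-elim (¬e e)
    to-from₁ x y z h ¬e (no ¬e′) = Frieze-≡ (∣-self x) (∣-self y)
      (∣-comb₃ (⌊⌋≡ ((⟦ x ⟧ + 1ℤ) * i)) h (proj₂ inv) 1ℤ (- i) ⟦ z ⟧ (eq ⟦ x ⟧ ⟦ y ⟧ ⟦ z ⟧ i ⟦ ⌊ (⟦ x ⟧ + 1ℤ) * i ⌋ ⟧))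
      where
      inv = inverse-mod pp (⟦ x ⟧ * ⟦ y ⟧ - 1ℤ) ¬e′
      i = proj₁ inv
      eq : ∀ x y z i w → w - z ≡ 1ℤ * (w - (x + 1ℤ) * i) + - i * (x * y * z - x - z - 1ℤ) + z * ((x * y - 1ℤ) * i - 1ℤ)
      eq = solve-∀

    -- When x y = 1 the cubic equation loses z and becomes x = -1; then y = -1 as well, and z is
    -- free.
    to-from₂ : ∀ x y z h → + p ∣ ⟦ x ⟧ * ⟦ y ⟧ - 1ℤ → ∀ {w} → + p ∣ ⟦ w ⟧ - ⟦ z ⟧ → degenerate w ≡ ((x , y , z) , h)
    to-from₂ x y z h e {w} = Frieze-≡
      (∣-comb₃ (⌊⌋≡ (- 1ℤ)) e h 1ℤ (- ⟦ z ⟧) 1ℤ (eq₁ ⟦ x ⟧ ⟦ y ⟧ ⟦ z ⟧ m))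
      (∣-comb₃ (⌊⌋≡ (- 1ℤ)) e h 1ℤ (1ℤ - ⟦ y ⟧ * ⟦ z ⟧) ⟦ y ⟧ (eq₂ ⟦ x ⟧ ⟦ y ⟧ ⟦ z ⟧ m))
      where
      m = ⟦ ⌊ - 1ℤ ⌋ ⟧
      eq₁ : ∀ x y z m → m - x ≡ 1ℤ * (m - - 1ℤ) + - z * (x * y - 1ℤ) + 1ℤ * (x * y * z - x - z - 1ℤ)
      eq₁ = solve-∀
      eq₂ : ∀ x y z m → m - y ≡ 1ℤ * (m - - 1ℤ) + (1ℤ - y * z) * (x * y - 1ℤ) + y * (x * y * z - x - z - 1ℤ)
      eq₂ = solve-∀

    to-from₃ : ∀ x y z h → + p ∣ ⟦ x ⟧ * ⟦ y ⟧ - 1ℤ → ∀ i → + p ∣ ⟦ z ⟧ * i - 1ℤ → ∀ d → fromPair z ⌊ i ⌋ d ≡ ((x , y , z) , h)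
    to-from₃ x y z h e i g (yes _) = to-from₂ x y z h e (∣-self z)
    to-from₃ x y z h e i g (no ¬g) = ⊥-elim (¬g (∣-comb₂ (⌊⌋≡ i) g ⟦ z ⟧ 1ℤ (eq ⟦ z ⟧ i ⟦ ⌊ i ⌋ ⟧)))
      where
      eq : ∀ z i j → z * j - 1ℤ ≡ z * (j - i) + 1ℤ * (z * i - 1ℤ)
      eq = solve-∀

    to-from₄ : ∀ x y z h d d′ → to (toPair x y z d d′) ≡ ((x , y , z) , h)
    to-from₄ x y z h (no ¬e) _         = to-from₁ x y z h ¬e (unit? x y)
    to-from₄ x y z h (yes e) (yes p∣z) = to-from₂ x y z h e (∣-comb₂ (⌊⌋≡ 0ℤ) p∣z 1ℤ (- 1ℤ) (eq ⟦ z ⟧ ⟦ ⌊ 0ℤ ⌋ ⟧))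
      where
      eq : ∀ z w → w - z ≡ 1ℤ * (w - 0ℤ) + - 1ℤ * z
      eq = solve-∀
    to-from₄ x y z h (yes e) (no p∤z)  = to-from₃ x y z h e (proj₁ inv) (proj₂ inv) (unit? z ⌊ proj₁ inv ⌋)
      where inv = inverse-mod pp ⟦ z ⟧ p∤z

    -- Of the p² pairs (x, y), the p - 1 with x y = 1 admit no z from the graph and are replaced by
    -- the p degenerate triples.
    cardinality : Fin (1 ℕ.+ p ℕ.* p) ↔ Frieze
    cardinality = ↔-trans Fin.+↔⊎ (↔-trans (Fin.1↔⊤ ⊎-↔ Fin.*↔×)
      (mk↔ₛ′ to from (λ ((x , y , z) , h) → to-from₄ x y z h (unit? x y) (zero? z)) from-to))

  root-exists : ∀ {p} → Prime p → ¬ 5 ∣ℕ 1 ℕ.+ p ℕ.* p → Root p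
  root-exists {p} pp 5∤ with Fin.any? (λ i → + p ℤ∣.∣? f ⟦ i ⟧)
  ... | yes r = r
  ... | no ¬r = ⊥-elim (5∤ (5∣cardinality _≟_ rotate rotate⁵ (λ s e → ¬r (fixed⇒root s e)) cardinality))
    where open Pentagon pp

  -- Roots and primitive representations

  Q : ℕ → ℕ → ℕ
  Q b v = b ℕ.* b ℕ.+ 3 ℕ.* b ℕ.* v ℕ.+ v ℕ.* v

  Qℤ : ℤ → ℤ → ℤ
  Qℤ b v = b * b + + 3 * b * v + v * v

  +Q : ∀ b v → + Q b v ≡ Qℤ (+ b) (+ v)
  +Q b v = cong₂ _+_ (cong₂ _+_ (ℤ.pos-* b b) (trans (ℤ.pos-* (3 ℕ.* b) v) (cong (_* + v) (ℤ.pos-* 3 b)))) (ℤ.pos-* v v)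

  +f : ∀ x → + (x ℕ.* x ℕ.+ 3 ℕ.* x ℕ.+ 1) ≡ f (+ x)
  +f x = cong₂ (λ a b → a + b + 1ℤ) (ℤ.pos-* x x) (ℤ.pos-* 3 x)

  -- A matrix (b v; b′ v′) of determinant 1 taking the form Q to the form with coefficients k, 2 x + 3, k′.
  record Rep (k x k′ : ℕ) : Set where
    constructor rep
    field
      {b v b′ v′} : ℕ
      det         : b ℕ.* v′ ≡ 1 ℕ.+ v ℕ.* b′
      value       : Q b v ≡ k
      value′      : Q b′ v′ ≡ k′
      cross       : b ℕ.* b′ ℕ.+ 3 ℕ.* v ℕ.* b′ ℕ.+ v ℕ.* v′ ≡ x

  -- The polarisation of Q contains 3 (b v′ + v b′). The determinant exchanges b v′ for 1 + v b′, so
  -- the middle coefficient becomes twice the asymmetric expression of `cross`, plus 3.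
  Q-+ : ∀ b v b′ v′ → b ℕ.* v′ ≡ 1 ℕ.+ v ℕ.* b′ →
        Q (b ℕ.+ b′) (v ℕ.+ v′) ≡
        Q b v ℕ.+ Q b′ v′ ℕ.+ 2 ℕ.* (b ℕ.* b′ ℕ.+ 3 ℕ.* v ℕ.* b′ ℕ.+ v ℕ.* v′) ℕ.+ 3
  Q-+ b v b′ v′ det = trans (eq₁ b v b′ v′)
    (trans (cong (λ d → Q b v ℕ.+ Q b′ v′ ℕ.+ 2 ℕ.* (b ℕ.* b′ ℕ.+ v ℕ.* v′) ℕ.+ 3 ℕ.* (d ℕ.+ v ℕ.* b′)) det)
      (eq₂ b v b′ v′))
    where
    eq₁ : ∀ b v b′ v′ →
      (b ℕ.+ b′) ℕ.* (b ℕ.+ b′) ℕ.+ 3 ℕ.* (b ℕ.+ b′) ℕ.* (v ℕ.+ v′) ℕ.+ (v ℕ.+ v′) ℕ.* (v ℕ.+ v′) ≡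
      (b ℕ.* b ℕ.+ 3 ℕ.* b ℕ.* v ℕ.+ v ℕ.* v) ℕ.+ (b′ ℕ.* b′ ℕ.+ 3 ℕ.* b′ ℕ.* v′ ℕ.+ v′ ℕ.* v′)
        ℕ.+ 2 ℕ.* (b ℕ.* b′ ℕ.+ v ℕ.* v′) ℕ.+ 3 ℕ.* (b ℕ.* v′ ℕ.+ v ℕ.* b′)
    eq₁ = ℕSolver.solve-∀
    eq₂ : ∀ b v b′ v′ →
      (b ℕ.* b ℕ.+ 3 ℕ.* b ℕ.* v ℕ.+ v ℕ.* v) ℕ.+ (b′ ℕ.* b′ ℕ.+ 3 ℕ.* b′ ℕ.* v′ ℕ.+ v′ ℕ.* v′)
        ℕ.+ 2 ℕ.* (b ℕ.* b′ ℕ.+ v ℕ.* v′) ℕ.+ 3 ℕ.* (1 ℕ.+ v ℕ.* b′ ℕ.+ v ℕ.* b′) ≡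
      (b ℕ.* b ℕ.+ 3 ℕ.* b ℕ.* v ℕ.+ v ℕ.* v) ℕ.+ (b′ ℕ.* b′ ℕ.+ 3 ℕ.* b′ ℕ.* v′ ℕ.+ v′ ℕ.* v′)
        ℕ.+ 2 ℕ.* (b ℕ.* b′ ℕ.+ 3 ℕ.* v ℕ.* b′ ℕ.+ v ℕ.* v′) ℕ.+ 3
    eq₂ = ℕSolver.solve-∀

  -- Adding the first row of the matrix to the second keeps the determinant and the value k, and
  -- shifts the root by k. `extendˡ` adds the second row to the first.
  extendʳ : ∀ {k y l} → Rep k y l → Rep k (y ℕ.+ k) (k ℕ.+ l ℕ.+ 2 ℕ.* y ℕ.+ 3)
  extendʳ (rep {b} {v} {b′} {v′} det refl refl refl) = rep {b = b} {v} {b ℕ.+ b′} {v ℕ.+ v′}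
    (trans (ℕ.*-distribˡ-+ b v v′) (trans (cong (b ℕ.* v ℕ.+_) det) (eq₁ b v b′))) refl (Q-+ b v b′ v′ det) (eq₂ b v b′ v′)
    where
    eq₁ : ∀ b v b′ → b ℕ.* v ℕ.+ (1 ℕ.+ v ℕ.* b′) ≡ 1 ℕ.+ v ℕ.* (b ℕ.+ b′)
    eq₁ = ℕSolver.solve-∀
    eq₂ : ∀ b v b′ v′ → b ℕ.* (b ℕ.+ b′) ℕ.+ 3 ℕ.* v ℕ.* (b ℕ.+ b′) ℕ.+ v ℕ.* (v ℕ.+ v′) ≡
      b ℕ.* b′ ℕ.+ 3 ℕ.* v ℕ.* b′ ℕ.+ v ℕ.* v′ ℕ.+ (b ℕ.* b ℕ.+ 3 ℕ.* b ℕ.* v ℕ.+ v ℕ.* v)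
    eq₂ = ℕSolver.solve-∀

  extendˡ : ∀ {l y k′} → Rep l y k′ → Rep (l ℕ.+ k′ ℕ.+ 2 ℕ.* y ℕ.+ 3) (y ℕ.+ k′) k′
  extendˡ (rep {b} {v} {b′} {v′} det refl refl refl) = rep {b = b ℕ.+ b′} {v ℕ.+ v′} {b′} {v′}
    (trans (ℕ.*-distribʳ-+ v′ b b′) (trans (cong (ℕ._+ b′ ℕ.* v′) det) (eq₁ v b′ v′))) (Q-+ b v b′ v′ det) refl (eq₂ b v b′ v′)
    where
    eq₁ : ∀ v b′ v′ → 1 ℕ.+ v ℕ.* b′ ℕ.+ b′ ℕ.* v′ ≡ 1 ℕ.+ (v ℕ.+ v′) ℕ.* b′
    eq₁ = ℕSolver.solve-∀
    eq₂ : ∀ b v b′ v′ → (b ℕ.+ b′) ℕ.* b′ ℕ.+ 3 ℕ.* (v ℕ.+ v′) ℕ.* b′ ℕ.+ (v ℕ.+ v′) ℕ.* v′ ≡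
      b ℕ.* b′ ℕ.+ 3 ℕ.* v ℕ.* b′ ℕ.+ v ℕ.* v′ ℕ.+ (b′ ℕ.* b′ ℕ.+ 3 ℕ.* b′ ℕ.* v′ ℕ.+ v′ ℕ.* v′)
    eq₂ = ℕSolver.solve-∀

  -- f(y + k) - f(y) = k (2 y + 3 + k), so subtracting k from a root preserves divisibility by k.
  -- The cofactor drops by k + 2 y + 3, the amount that `extendʳ` restores.
  reduce : ∀ k k′ y → k ℕ.* k′ ≡ (y ℕ.+ k) ℕ.* (y ℕ.+ k) ℕ.+ 3 ℕ.* (y ℕ.+ k) ℕ.+ 1 →
           ∃ λ l → k ℕ.* l ≡ y ℕ.* y ℕ.+ 3 ℕ.* y ℕ.+ 1 × k ℕ.+ l ℕ.+ 2 ℕ.* y ℕ.+ 3 ≡ k′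
  reduce zero k′ y h = ⊥-elim (ℕ.m+1+n≢0 _ (sym h))
  reduce k@(suc _) k′ y h = l , sym l-eq , ℕ.*-cancelˡ-≡ _ _ k (sym (begin
    k ℕ.* k′                                         ≡⟨ h′ ⟩
    g ℕ.+ k ℕ.* (2 ℕ.* y ℕ.+ 3 ℕ.+ k)                ≡⟨ cong (ℕ._+ k ℕ.* (2 ℕ.* y ℕ.+ 3 ℕ.+ k)) l-eq ⟩
    k ℕ.* l ℕ.+ k ℕ.* (2 ℕ.* y ℕ.+ 3 ℕ.+ k)          ≡⟨ eq₂ k l y ⟩
    k ℕ.* (k ℕ.+ l ℕ.+ 2 ℕ.* y ℕ.+ 3)                ∎))
    where
    open ≡-Reasoning
    g = y ℕ.* y ℕ.+ 3 ℕ.* y ℕ.+ 1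
    eq₁ : ∀ k y → (y ℕ.+ k) ℕ.* (y ℕ.+ k) ℕ.+ 3 ℕ.* (y ℕ.+ k) ℕ.+ 1 ≡
      y ℕ.* y ℕ.+ 3 ℕ.* y ℕ.+ 1 ℕ.+ k ℕ.* (2 ℕ.* y ℕ.+ 3 ℕ.+ k)
    eq₁ = ℕSolver.solve-∀
    eq₂ : ∀ k l y → k ℕ.* l ℕ.+ k ℕ.* (2 ℕ.* y ℕ.+ 3 ℕ.+ k) ≡ k ℕ.* (k ℕ.+ l ℕ.+ 2 ℕ.* y ℕ.+ 3)
    eq₂ = ℕSolver.solve-∀
    h′ : k ℕ.* k′ ≡ g ℕ.+ k ℕ.* (2 ℕ.* y ℕ.+ 3 ℕ.+ k)
    h′ = trans h (eq₁ k y)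
    k∣g : k ∣ℕ g
    k∣g = ℕ∣.∣m+n∣m⇒∣n (subst (k ∣ℕ_) (trans h′ (ℕ.+-comm g _)) (ℕ∣.m∣m*n k′)) (ℕ∣.m∣m*n (2 ℕ.* y ℕ.+ 3 ℕ.+ k))
    l = ℕ∣.quotient k∣g
    l-eq : g ≡ k ℕ.* l
    l-eq = ℕ∣.m∣n⇒n≡m*quotient k∣g

  -- f(x) exceeds (x + 1)² by x only, whereas a positive i or j adds at least x + 1 to the product.
  -- Thus the sole form at which the descent stops is Q itself, which is class number one.
  reduced-trivial : ∀ x i j → (suc x ℕ.+ i) ℕ.* (suc x ℕ.+ j) ≡ x ℕ.* x ℕ.+ 3 ℕ.* x ℕ.+ 1 → x ≡ 0 × i ≡ 0 × j ≡ 0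
  reduced-trivial x i j h = go i j (ℕ.+-cancelˡ-≡ (x ℕ.* x ℕ.+ 2 ℕ.* x ℕ.+ 1) _ _ (trans (sym (eq₁ x i j)) (trans h (eq₂ x))))
    where
    eq₁ : ∀ x i j → (suc x ℕ.+ i) ℕ.* (suc x ℕ.+ j) ≡
      x ℕ.* x ℕ.+ 2 ℕ.* x ℕ.+ 1 ℕ.+ ((i ℕ.+ j) ℕ.* suc x ℕ.+ i ℕ.* j)
    eq₁ = ℕSolver.solve-∀
    eq₂ : ∀ x → x ℕ.* x ℕ.+ 3 ℕ.* x ℕ.+ 1 ≡ x ℕ.* x ℕ.+ 2 ℕ.* x ℕ.+ 1 ℕ.+ x
    eq₂ = ℕSolver.solve-∀
    big : ∀ s t → ¬ (suc x ℕ.+ s) ℕ.+ t ≡ x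
    big s t e = ℕ.m≢1+m+n x (trans (sym e) (cong suc (ℕ.+-assoc x s t)))
    go : ∀ i j → (i ℕ.+ j) ℕ.* suc x ℕ.+ i ℕ.* j ≡ x → x ≡ 0 × i ≡ 0 × j ≡ 0
    go zero    zero    e = sym e , refl , refl
    go zero    (suc j) e = ⊥-elim (big _ _ e)
    go (suc i) j       e = ⊥-elim (big _ _ e)

  -- Reduction theory of the discriminant 5: as long as x is at least one of the
  -- outer coefficients, subtracting it undoes one of the two extensions above.
  represent : ∀ k x k′ → k ℕ.* k′ ≡ x ℕ.* x ℕ.+ 3 ℕ.* x ℕ.+ 1 → Rep k x k′
  represent k x k′ = go x (<-wellFounded x) k k′
    where
    positive : ∀ k k′ {n} → k ℕ.* k′ ≡ n ℕ.+ 1 → 0 ℕ.< k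
    positive zero    _ {n} h = ⊥-elim (ℕ.m+1+n≢0 n (sym h))
    positive (suc _) _     _ = ℕ.z<s
    go : ∀ x → Acc ℕ._<_ x → ∀ k k′ → k ℕ.* k′ ≡ x ℕ.* x ℕ.+ 3 ℕ.* x ℕ.+ 1 → Rep k x k′
    go x (acc rec) k k′ h with ℕ.≤-<-connex k x
    ... | inj₁ k≤x = subst₂ (Rep k) y+k (proj₂ (proj₂ red)) (extendʳ (go y (rec y<x) k (proj₁ red) (proj₁ (proj₂ red))))
      where
      y = x ℕ.∸ k
      y+k : y ℕ.+ k ≡ x
      y+k = ℕ.m∸n+n≡m k≤x
      red = reduce k k′ y (trans h (cong (λ x → x ℕ.* x ℕ.+ 3 ℕ.* x ℕ.+ 1) (sym y+k)))
      y<x : y ℕ.< x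
      y<x = ℕ.∸-monoʳ-< (positive k k′ h) k≤x
    ... | inj₂ x<k with ℕ.≤-<-connex k′ x
    ...   | inj₁ k′≤x = subst₂ (λ k x → Rep k x k′) (trans (cong (λ s → s ℕ.+ 2 ℕ.* y ℕ.+ 3) (ℕ.+-comm l k′)) (proj₂ (proj₂ red))) y+k′
        (extendˡ (go y (rec y<x) l k′ (trans (ℕ.*-comm l k′) (proj₁ (proj₂ red)))))
      where
      y = x ℕ.∸ k′
      y+k′ : y ℕ.+ k′ ≡ x
      y+k′ = ℕ.m∸n+n≡m k′≤x
      h′ = trans (ℕ.*-comm k′ k) h
      red = reduce k′ k y (trans h′ (cong (λ x → x ℕ.* x ℕ.+ 3 ℕ.* x ℕ.+ 1) (sym y+k′)))
      l = proj₁ red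
      y<x : y ℕ.< x
      y<x = ℕ.∸-monoʳ-< (positive k′ k h′) k′≤x
    ...   | inj₂ x<k′ = base (reduced-trivial x (k ℕ.∸ suc x) (k′ ℕ.∸ suc x)
              (trans (cong₂ ℕ._*_ (ℕ.m+[n∸m]≡n x<k) (ℕ.m+[n∸m]≡n x<k′)) h)) (sym (ℕ.m+[n∸m]≡n x<k)) (sym (ℕ.m+[n∸m]≡n x<k′))
      where
      base : ∀ {x i j k k′} → x ≡ 0 × i ≡ 0 × j ≡ 0 → k ≡ suc x ℕ.+ i → k′ ≡ suc x ℕ.+ j → Rep k x k′
      base (refl , refl , refl) refl refl = rep {b = 1} {0} {0} {1} refl refl refl refl

  Prim : ℕ → Set
  Prim k = Σ (ℕ × ℕ) λ (b , v) → 1 ℕ.≤ b × gcd b v ≡ 1 × Q b v ≡ k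

  Prim-≡ : ∀ {k} {s t : Prim k} → proj₁ s ≡ proj₁ t → s ≡ t
  Prim-≡ {s = _ , a , b , c} {_ , a′ , b′ , c′} refl
    with refl ← ℕ.≤-irrelevant a a′ | refl ← ≡-irrelevant b b′ | refl ← ≡-irrelevant c c′ = refl

  -- The root attached to a representation is the slope v / b modulo k.
  Slope : ℕ → ℤ → ℤ → ℤ → Set
  Slope k x b v = + k ∣ x * b - v

  -- The formula is forced: x b = v and f(x) = 0 give x v = x² b = -3 v - b, and multiplying x by s
  -- b + t v = 1 yields s v - t b - 3 t v. The arguments are integers so that a negative second
  -- coordinate is allowed.
  slope : ∀ {k} b v → Bézoutℤ b v → Qℤ b v ≡ + k → ∃ λ x → + k ∣ f x × Slope k x b v
  slope {k} b v (s , t , e) h = s * v - t * b - + 3 * t * v ,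
    ∣-comb₂ k∣Q (≡⇒∣- e) (t * t - + 3 * t * s + s * s) (- (+ 3 * (s * v - t * b - + 3 * t * v) + (s * b + t * v) + 1ℤ)) (eq₁ b v s t) ,
    ∣-comb₂ k∣Q (≡⇒∣- e) (- t) v (eq₂ b v s t)
    where
    k∣Q : + k ∣ Qℤ b v
    k∣Q = divides 1ℤ (trans h (sym (ℤ.*-identityˡ (+ k))))
    eq₁ : ∀ b v s t → let x = s * v - t * b - + 3 * t * v in
      x * x + + 3 * x + 1ℤ ≡ (t * t - + 3 * t * s + s * s) * (b * b + + 3 * b * v + v * v)
        + - (+ 3 * x + (s * b + t * v) + 1ℤ) * (s * b + t * v - 1ℤ)
    eq₁ = solve-∀
    eq₂ : ∀ b v s t → (s * v - t * b - + 3 * t * v) * b - v ≡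
      - t * (b * b + + 3 * b * v + v * v) + v * (s * b + t * v - 1ℤ)
    eq₂ = solve-∀

  -- (x - y) b vanishes modulo k, and so does (x - y) v because v ≡ y b; Bézout combines the two.
  slope-unique : ∀ {k} x y b v → Bézoutℤ b v → Slope k x b v → Slope k y b v → + k ∣ x - y
  slope-unique {k} x y b v (s , t , e) hx hy = ∣-comb₃ hx hy (≡⇒∣- e)
    (s + t * y) (- (s + t * y) - t * (x - y)) (- (x - y)) (eq b v s t x y)
    where
    eq : ∀ b v s t x y → x - y ≡ (s + t * y) * (x * b - v) + (- (s + t * y) - t * (x - y)) * (y * b - v)
      + - (x - y) * (s * b + t * v - 1ℤ)
    eq = solve-∀

  Slope-cong : ∀ {k} x y b v → + k ∣ x - y → Slope k y b v → Slope k x b v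
  Slope-cong x y b v h i = ∣-comb₂ h i b 1ℤ (eq x y b v)
    where
    eq : ∀ x y b v → x * b - v ≡ b * (x - y) + 1ℤ * (y * b - v)
    eq = solve-∀

  -- With equal slopes, k divides b w - c v, and both products lie below k.
  *-<-Q : ∀ {k b v c w} → 1 ℕ.≤ c → Q b v ≡ k → Q c w ≡ k → b ℕ.* w ℕ.< k
  *-<-Q {k} {b} {v} {c} {w} 1≤c hb hc = ℕ.≰⇒> λ k≤bw → ℕ.<⇒≱
    (begin-strict
      b ℕ.* w ℕ.* (b ℕ.* w)       ≡⟨ eq b w ⟩
      b ℕ.* b ℕ.* (w ℕ.* w)       ≤⟨ ℕ.*-monoˡ-≤ (w ℕ.* w) b²≤k ⟩
      k ℕ.* (w ℕ.* w)             <⟨ ℕ.*-monoʳ-< k w²<k ⟩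
      k ℕ.* k                     ∎)
    (ℕ.*-mono-≤ k≤bw k≤bw)
    where
    open ℕ.≤-Reasoning
    eq : ∀ b w → b ℕ.* w ℕ.* (b ℕ.* w) ≡ b ℕ.* b ℕ.* (w ℕ.* w)
    eq = ℕSolver.solve-∀
    b²≤k : b ℕ.* b ℕ.≤ k
    b²≤k = subst (b ℕ.* b ℕ.≤_) hb (ℕ.≤-trans (ℕ.m≤m+n _ _) (ℕ.m≤m+n _ _))
    w²<k : w ℕ.* w ℕ.< k
    w²<k = subst (w ℕ.* w ℕ.<_) hc (ℕ.+-monoˡ-≤ (w ℕ.* w) (ℕ.≤-trans (ℕ.*-mono-≤ 1≤c 1≤c) (ℕ.m≤m+n _ _)))
    instance
      k≢0 : ℕ.NonZero k
      k≢0 = ℕ.>-nonZero (ℕ.≤-<-trans ℕ.z≤n w²<k)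

  slope-injective : ∀ {k x} (s t : Prim k) → let (b , v) = proj₁ s ; (c , w) = proj₁ t in
                    Slope k x (+ b) (+ v) → Slope k x (+ c) (+ w) → s ≡ t
  slope-injective {k} {x} s@((b , v) , 1≤b , gb , hb) t@((c , w) , 1≤c , gc , hc) p q = Prim-≡ (cong₂ _,_ b≡c v≡w)
    where
    eq : ∀ x b v c w → b * w - c * v ≡ c * (x * b - v) + - b * (x * c - w)
    eq = solve-∀
    bw≡cv : b ℕ.* w ≡ c ℕ.* v
    bw≡cv = +-injective-mod (*-<-Q {b = b} {v} {c} 1≤c hb hc) (*-<-Q {b = c} {w} {b} 1≤b hc hb)
      (subst (+ k ∣_) (sym (cong₂ _-_ (ℤ.pos-* b w) (ℤ.pos-* c v))) (∣-comb₂ p q (+ c) (- + b) (eq x (+ b) (+ v) (+ c) (+ w))))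
    b∣c : b ∣ℕ c
    b∣c = coprime-divisor (gcd≡1⇒coprime gb) (subst (b ∣ℕ_) (trans bw≡cv (ℕ.*-comm c v)) (ℕ∣.m∣m*n w))
    c∣b : c ∣ℕ b
    c∣b = coprime-divisor (gcd≡1⇒coprime gc) (subst (c ∣ℕ_) (trans (sym bw≡cv) (ℕ.*-comm b w)) (ℕ∣.m∣m*n v))
    b≡c : b ≡ c
    b≡c = ℕ∣.∣-antisym b∣c c∣b
    v≡w : v ≡ w
    v≡w = ℕ.*-cancelˡ-≡ v w b {{ℕ.>-nonZero 1≤b}} (trans (cong (ℕ._* v) b≡c) (sym bw≡cv))

  -- The determinant makes the first row primitive. Eliminating b v′ with it turns x b into v + b′
  -- k, so the slope of that row is x.
  Rep⇒Prim : ∀ {k x k′} → Rep k x k′ → Σ (Prim k) λ s → Slope k (+ x) (+ proj₁ (proj₁ s)) (+ proj₂ (proj₁ s))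
  Rep⇒Prim {k} {x} (rep {b} {v} {b′} {v′} det refl _ refl) = ((b , v) , 1≤b b det , coprime⇒gcd≡1 coprime , refl) , sl
    where
    1≤b : ∀ b → b ℕ.* v′ ≡ 1 ℕ.+ v ℕ.* b′ → 1 ℕ.≤ b
    1≤b (suc b) _ = ℕ.z<s
    coprime : Coprime b v
    coprime {d} (d∣b , d∣v) = ℕ∣.∣1⇒≡1 (ℕ∣.∣m+n∣m⇒∣n
      (subst (d ∣ℕ_) (trans det (ℕ.+-comm 1 _)) (ℕ∣.∣m⇒∣m*n v′ d∣b)) (ℕ∣.∣m⇒∣m*n b′ d∣v))
    eq₁ : ∀ b v b′ v′ → (b ℕ.* b′ ℕ.+ 3 ℕ.* v ℕ.* b′ ℕ.+ v ℕ.* v′) ℕ.* b ≡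
      v ℕ.* (b ℕ.* v′) ℕ.+ b′ ℕ.* (b ℕ.* b ℕ.+ 3 ℕ.* b ℕ.* v)
    eq₁ = ℕSolver.solve-∀
    eq₂ : ∀ b v b′ → v ℕ.* (1 ℕ.+ v ℕ.* b′) ℕ.+ b′ ℕ.* (b ℕ.* b ℕ.+ 3 ℕ.* b ℕ.* v) ≡
      v ℕ.+ b′ ℕ.* (b ℕ.* b ℕ.+ 3 ℕ.* b ℕ.* v ℕ.+ v ℕ.* v)
    eq₂ = ℕSolver.solve-∀
    xb : x ℕ.* b ≡ v ℕ.+ b′ ℕ.* Q b v
    xb = trans (eq₁ b v b′ v′) (trans (cong (λ d → v ℕ.* d ℕ.+ b′ ℕ.* (b ℕ.* b ℕ.+ 3 ℕ.* b ℕ.* v)) det) (eq₂ b v b′))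
    eq₃ : ∀ v y → v + y - v ≡ y
    eq₃ = solve-∀
    sl : Slope (Q b v) (+ x) (+ b) (+ v)
    sl = divides (+ b′) (trans (cong (_- + v) (trans (sym (ℤ.pos-* x b)) (cong +_ xb)))
           (trans (eq₃ (+ v) (+ (b′ ℕ.* Q b v))) (ℤ.pos-* b′ (Q b v))))

  Root⇒Prim : ∀ {k} (r : Root k) → Σ (Prim k) λ s → Slope k ⟦ proj₁ r ⟧ (+ proj₁ (proj₁ s)) (+ proj₂ (proj₁ s))
  Root⇒Prim {k} (i , h) = Rep⇒Prim (represent k (toℕ i) (ℕ∣.quotient h′) (sym (ℕ∣.m∣n⇒n≡m*quotient h′)))
    where
    h′ : k ∣ℕ toℕ i ℕ.* toℕ i ℕ.+ 3 ℕ.* toℕ i ℕ.+ 1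
    h′ = +∣+⇒∣ (subst (+ k ∣_) (sym (+f (toℕ i))) h)

  Prim↔Root : ∀ k .{{_ : ℕ.NonZero k}} → Prim k ↔ Root k
  Prim↔Root k = mk↔ₛ′ to from to-from from-to
    where
    bez : (s : Prim k) → Bézoutℤ (+ proj₁ (proj₁ s)) (+ proj₂ (proj₁ s))
    bez ((b , v) , _ , g , _) = coprime⇒Bézoutℤ (gcd≡1⇒coprime g)
    sl : (s : Prim k) → ∃ λ x → + k ∣ f x × Slope k x (+ proj₁ (proj₁ s)) (+ proj₂ (proj₁ s))
    sl s@((b , v) , _ , _ , h) = slope (+ b) (+ v) (bez s) (trans (sym (+Q b v)) (cong +_ h))
    to : Prim k → Root k
    to s = toRoot k (proj₁ (sl s)) (proj₁ (proj₂ (sl s)))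
    from : Root k → Prim k
    from r = proj₁ (Root⇒Prim r)
    to-slope : (s : Prim k) → Slope k ⟦ proj₁ (to s) ⟧ (+ proj₁ (proj₁ s)) (+ proj₂ (proj₁ s))
    to-slope s = Slope-cong ⟦ proj₁ (to s) ⟧ (proj₁ (sl s)) (+ proj₁ (proj₁ s)) (+ proj₂ (proj₁ s))
      (residue-≡ k (proj₁ (sl s))) (proj₂ (proj₂ (sl s)))
    to-from : ∀ r → to (from r) ≡ r
    to-from r = Root-≡ {r = to (from r)} {r}
      (slope-unique ⟦ proj₁ (to (from r)) ⟧ ⟦ proj₁ r ⟧ (+ proj₁ (proj₁ (from r))) (+ proj₂ (proj₁ (from r)))
        (bez (from r)) (to-slope (from r)) (proj₂ (Root⇒Prim r)))
    from-to : ∀ s → from (to s) ≡ s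
    from-to s = slope-injective {x = ⟦ proj₁ (to s) ⟧} (from (to s)) s (proj₂ (Root⇒Prim (to s))) (to-slope s)

  -- The Legendre symbol modulo 5 on values of Q

  legendre5-residue : ℕ → ℤ
  legendre5-residue r = if r ℕ.≡ᵇ 0 then + 0 else if any (λ x → ((x ℕ.* x) % 5) ℕ.≡ᵇ r) (upTo 5) then + 1 else -[1+ 0 ]

  legendre5-square : ∀ b → legendre5 (b ℕ.* b) ≢ -[1+ 0 ]
  legendre5-square b e = go (b % 5) (m%n<n b 5) (trans (cong legendre5-residue (sym (%-distribˡ-* b b 5))) e)
    where
    go : ∀ r → r ℕ.< 5 → legendre5-residue ((r ℕ.* r) % 5) ≢ -[1+ 0 ]
    go 0 _ ()
    go 1 _ ()
    go 2 _ ()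
    go 3 _ ()
    go 4 _ ()
    go (suc (suc (suc (suc (suc _))))) (ℕ.s≤s (ℕ.s≤s (ℕ.s≤s (ℕ.s≤s (ℕ.s≤s ())))))

  legendre5-Q : ∀ b v → legendre5 (Q b v) ≢ -[1+ 0 ]
  -- The 4 stands for -1 in ℕ: modulo 5, b² + 3 b v + v² is (b - v)².
  legendre5-Q b v e = legendre5-square (b ℕ.+ 4 ℕ.* v) (trans (cong legendre5-residue (trans (cong (_% 5) (eq b v))
    ([m+kn]%n≡m%n (Q b v) (b ℕ.* v ℕ.+ 3 ℕ.* (v ℕ.* v)) 5))) e)
    where
    eq : ∀ b v → (b ℕ.+ 4 ℕ.* v) ℕ.* (b ℕ.+ 4 ℕ.* v) ≡
      b ℕ.* b ℕ.+ 3 ℕ.* b ℕ.* v ℕ.+ v ℕ.* v ℕ.+ (b ℕ.* v ℕ.+ 3 ℕ.* (v ℕ.* v)) ℕ.* 5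
    eq = ℕSolver.solve-∀

  Root⇒legendre5 : ∀ {k} → Root k → legendre5 k ≢ -[1+ 0 ]
  Root⇒legendre5 r with proj₁ (Root⇒Prim r)
  ... | (b , v) , _ , _ , refl = legendre5-Q b v

  -- Counting roots

  ≡⇒Fin↔ : ∀ {m n} → m ≡ n → Fin m ↔ Fin n
  ≡⇒Fin↔ refl = ↔-refl

  primeDivisors-unique : ∀ n → Unique (primeDivisors n)
  primeDivisors-unique n = Unique.filter⁺ (ℕ∣._∣? n) (Unique.filter⁺ prime? (Unique.upTo⁺ (suc n)))

  ∈-primeDivisors⁺ : ∀ {n p} .{{_ : ℕ.NonZero n}} → Prime p → p ∣ℕ n → p ∈ primeDivisors n
  ∈-primeDivisors⁺ {n} pp h = ∈-filter⁺ (ℕ∣._∣? n) (∈-filter⁺ prime? (∈-upTo⁺ (ℕ.s≤s (ℕ∣.∣⇒≤ h))) pp) h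

  ∈-primeDivisors⁻ : ∀ {n p} → p ∈ primeDivisors n → Prime p × p ∣ℕ n
  ∈-primeDivisors⁻ {n} i with ∈-filter⁻ (ℕ∣._∣? n) {xs = filter prime? (upTo (suc n))} i
  ... | j , h = proj₂ (∈-filter⁻ prime? {xs = upTo (suc n)} j) , h

  prime∣prime⇒≡ : ∀ {p q} → Prime p → Prime q → p ∣ℕ q → p ≡ q
  prime∣prime⇒≡ pp qp h with prime⇒irreducible qp h
  ... | inj₁ refl = ⊥-elim (¬prime[1] pp)
  ... | inj₂ eq   = eq

  module _ {p k} (pp : Prime p) .{{k≢0 : ℕ.NonZero k}} where

    private
      instance
        _ = prime⇒nonZero pp
        _ = ℕ.m*n≢0 p k

      ∣-* : ∀ {q} → Prime q → q ∣ℕ p ℕ.* k → q ≡ p ⊎ q ∣ℕ k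
      ∣-* qp h = Sum.map₁ (prime∣prime⇒≡ qp pp) (euclidsLemma p k qp h)

    ω-*-∣ : p ∣ℕ k → ω (p ℕ.* k) ≡ ω k
    ω-*-∣ p∣k = ⊆-antisym⇒length≡ (primeDivisors-unique (p ℕ.* k)) (primeDivisors-unique k) to from
      where
      to : ∀ {q} → q ∈ primeDivisors (p ℕ.* k) → q ∈ primeDivisors k
      to i with ∈-primeDivisors⁻ {p ℕ.* k} i
      ... | qp , h = ∈-primeDivisors⁺ qp ([ (λ { refl → p∣k }) , (λ h → h) ]′ (∣-* qp h))
      from : ∀ {q} → q ∈ primeDivisors k → q ∈ primeDivisors (p ℕ.* k)
      from i with ∈-primeDivisors⁻ {k} i
      ... | qp , h = ∈-primeDivisors⁺ qp (ℕ∣.∣n⇒∣m*n p h)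

    ω-*-∤ : ¬ p ∣ℕ k → ω (p ℕ.* k) ≡ suc (ω k)
    ω-*-∤ p∤k = ⊆-antisym⇒length≡ (primeDivisors-unique (p ℕ.* k)) (Unique.++⁺ ([] ∷ []) (primeDivisors-unique k) disjoint) to from
      where
      disjoint : ∀ {q} → ¬ (q ∈ p ∷ [] × q ∈ primeDivisors k)
      disjoint (here refl , i) = p∤k (proj₂ (∈-primeDivisors⁻ {k} i))
      to : ∀ {q} → q ∈ primeDivisors (p ℕ.* k) → q ∈ p ∷ primeDivisors k
      to i with ∈-primeDivisors⁻ {p ℕ.* k} i
      ... | qp , h = [ here , there ∘ ∈-primeDivisors⁺ qp ]′ (∣-* qp h)
      from : ∀ {q} → q ∈ p ∷ primeDivisors k → q ∈ primeDivisors (p ℕ.* k)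
      from (here refl) = ∈-primeDivisors⁺ pp (ℕ∣.m∣m*n k)
      from (there i) with ∈-primeDivisors⁻ {k} i
      ... | qp , h = ∈-primeDivisors⁺ qp (ℕ∣.∣n⇒∣m*n p h)

  -- p² ≡ -1 modulo 5 means p ≡ ±2, the non-residues; this is where the orbit count meets the
  -- Legendre symbol.
  5∤1+p² : ∀ p → legendre5 p ≢ -[1+ 0 ] → ¬ 5 ∣ℕ 1 ℕ.+ p ℕ.* p
  5∤1+p² p l h = go (p % 5) (m%n<n p 5) l
    (trans (cong (λ r → (1 ℕ.+ r) % 5) (sym (%-distribˡ-* p p 5))) (trans (sym (%-distribˡ-+ 1 (p ℕ.* p) 5)) (n∣m⇒m%n≡0 _ 5 h)))
    where
    go : ∀ r → r ℕ.< 5 → legendre5-residue r ≢ -[1+ 0 ] → (1 ℕ.+ (r ℕ.* r) % 5) % 5 ≢ 0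
    go 0 _ _ ()
    go 1 _ _ ()
    go 2 _ l _ = l refl
    go 3 _ l _ = l refl
    go 4 _ _ ()
    go (suc (suc (suc (suc (suc _))))) (ℕ.s≤s (ℕ.s≤s (ℕ.s≤s (ℕ.s≤s (ℕ.s≤s ())))))

  -- The excluded primes, those ≡ ±2 modulo 5, are the ones that stay prime in ℚ(√5).
  NonInert : ℕ → Set
  NonInert k = ∀ p → Prime p → p ∣ℕ k → legendre5 p ≢ -[1+ 0 ]

  Root-1 : Root 1 ↔ Fin 1
  Root-1 = ↔Fin1 (Fin.zero , divides 1ℤ refl) (λ { (Fin.zero , h) → cong (Fin.zero ,_) (∣-irrelevant h _) ; (Fin.suc () , _) })

  -- One prime factor is added at a time: a prime already present leaves the number of roots
  -- unchanged by Newton lifting, a new one doubles it by the Chinese remainder theorem.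
  root-count-product : ∀ ps → All Prime ps → NonInert (product ps) → ¬ 5 ∣ℕ product ps → Root (product ps) ↔ Fin (2 ℕ.^ ω (product ps))
  root-count-product []       _          _ _  = Root-1
  root-count-product (p ∷ ps) (pp ∷ pps) l 5∤ = go (p ℕ∣.∣? k)
    where
    k = product ps
    instance
      _ = prime⇒nonZero pp
      _ = productOfPrimes≢0 pps
    p≢5 : p ≢ 5
    p≢5 refl = 5∤ (ℕ∣.m∣m*n k)
    p⊥5 : Coprime p 5
    p⊥5 = prime⇒coprime-∤ pp (p≢5 ∘ prime∣prime⇒≡ pp prime[5])
    ih : Root k ↔ Fin (2 ℕ.^ ω k)
    ih = root-count-product ps pps (λ q qp h → l q qp (ℕ∣.∣n⇒∣m*n p h)) (5∤ ∘ ℕ∣.∣n⇒∣m*n p)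
    go : Dec (p ∣ℕ k) → Root (p ℕ.* k) ↔ Fin (2 ℕ.^ ω (p ℕ.* k))
    go (yes p∣k) = ↔-trans (Root-lift p k p⊥5 p∣k) (↔-trans ih (≡⇒Fin↔ (cong (2 ℕ.^_) (sym (ω-*-∣ pp p∣k)))))
    go (no p∤k)  = ↔-trans (Root-* p k (prime⇒coprime-∤ pp p∤k)) (↔-trans (Root-prime pp p≢5 r ×-↔ ih)
      (↔-trans (↔-sym Fin.*↔×) (≡⇒Fin↔ (cong (2 ℕ.^_) (sym (ω-*-∤ pp p∤k))))))
      where
      r : Root p
      r = root-exists pp (5∤1+p² p (l p pp (ℕ∣.m∣m*n k)))

  root-count-∤5 : ∀ k .{{_ : ℕ.NonZero k}} → NonInert k → ¬ 5 ∣ℕ k → Root k ↔ Fin (2 ℕ.^ ω k)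
  root-count-∤5 k l 5∤ = subst (λ k → Root k ↔ Fin (2 ℕ.^ ω k)) (sym isFactorisation)
    (root-count-product factors factorsPrime (subst NonInert isFactorisation l) (subst (λ k → ¬ 5 ∣ℕ k) isFactorisation 5∤))
    where open PrimeFactorisation (factorise k)

  -- `w` counts the prime divisors other than 5, since the single root modulo 5 contributes a factor
  -- 1. Excluding 25 leaves a cofactor prime to 5.
  root-count : ∀ k .{{_ : ℕ.NonZero k}} → NonInert k → ¬ 25 ∣ℕ k →
          ∃ λ w → (Root k ↔ Fin (2 ℕ.^ w)) × ((5 ∣ℕ k × ω k ≡ suc w) ⊎ (¬ 5 ∣ℕ k × ω k ≡ w))
  root-count k l 25∤ with 5 ℕ∣.∣? k
  ... | no 5∤ = ω k , root-count-∤5 k l 5∤ , inj₂ (5∤ , refl)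
  ... | yes 5∣k@(ℕ∣.divides j refl) = ω j ,
      subst (λ k → Root k ↔ Fin (2 ℕ.^ ω j)) (ℕ.*-comm 5 j)
        (↔-trans (Root-* 5 j (prime⇒coprime-∤ prime[5] 5∤j))
          (↔-trans (Root-5 ×-↔ root-count-∤5 j (λ q qp h → l q qp (ℕ∣.∣m⇒∣m*n 5 h)) 5∤j)
          (↔-trans (↔-sym Fin.*↔×) (≡⇒Fin↔ (ℕ.*-identityˡ _))))) ,
      inj₁ (5∣k , trans (cong ω (ℕ.*-comm j 5)) (ω-*-∤ prime[5] 5∤j))
    where
    instance
      j≢0 : ℕ.NonZero j
      j≢0 = ℕ.m*n≢0⇒m≢0 j
    5∤j : ¬ 5 ∣ℕ j
    5∤j h = 25∤ (ℕ∣.*-monoˡ-∣ 5 h)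

  SquareFree⇒25∤ : ∀ {C} → SquareFree C → ¬ 25 ∣ℕ C
  SquareFree⇒25∤ sf = sf 5 prime[5]

  squareFree-root : ∀ C .{{_ : ℕ.NonZero C}} → NonInert C → SquareFree C → Root C
  squareFree-root C l sf with root-count C l (SquareFree⇒25∤ sf)
  ... | w , e , _ = Inverse.from e (Fin.fromℕ< (ℕ.m^n>0 2 w))

  legendre5-5∣ : ∀ {n} → 5 ∣ℕ n → legendre5 n ≡ + 0
  legendre5-5∣ {n} h = cong legendre5-residue (n∣m⇒m%n≡0 n 5 h)

  legendre5-5∤ : ∀ {n} → ¬ 5 ∣ℕ n → legendre5 n ≢ -[1+ 0 ] → legendre5 n ≡ + 1
  legendre5-5∤ {n} 5∤ l = go (n % 5) (5∤ ∘ m%n≡0⇒n∣m n 5) (m%n<n n 5) l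
    where
    go : ∀ r → r ≢ 0 → r ℕ.< 5 → legendre5-residue r ≢ -[1+ 0 ] → legendre5-residue r ≡ + 1
    go 0 r≢0 _ _ = ⊥-elim (r≢0 refl)
    go 1 _ _ _ = refl
    go 2 _ _ l = ⊥-elim (l refl)
    go 3 _ _ l = ⊥-elim (l refl)
    go 4 _ _ _ = refl
    go (suc (suc (suc (suc (suc _))))) _ (ℕ.s≤s (ℕ.s≤s (ℕ.s≤s (ℕ.s≤s (ℕ.s≤s ())))))

  -- The term l - 1 is -1 exactly when 5 divides C, equivalently k, and then it discounts the prime
  -- 5 from `ω k`; otherwise it is 0. In both cases the integer inside the absolute value is the
  -- non-negative `w`.
  root-count-legendre : ∀ k C .{{_ : ℕ.NonZero k}} → NonInert k → ¬ 25 ∣ℕ k → (5 ∣ℕ k → 5 ∣ℕ C) → (5 ∣ℕ C → 5 ∣ℕ k) →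
                   legendre5 C ≢ -[1+ 0 ] → Fin (2 ℕ.^ ℤ.∣ + ω k + legendre5 C - + 1 ∣) ↔ Root k
  root-count-legendre k C l 25∤ i j lC with root-count k l 25∤
  ... | w , e , inj₁ (5∣k , ωk) rewrite ωk | legendre5-5∣ (i 5∣k) =
    ↔-trans (≡⇒Fin↔ (cong (λ z → 2 ℕ.^ ℤ.∣ z ∣) (eq (+ w)))) (↔-sym e)
    where
    eq : ∀ w → 1ℤ + w + + 0 - + 1 ≡ w
    eq = solve-∀
  ... | w , e , inj₂ (5∤k , ωk) rewrite ωk | legendre5-5∤ (5∤k ∘ j) lC =
    ↔-trans (≡⇒Fin↔ (cong (λ z → 2 ℕ.^ ℤ.∣ z ∣) (eq (+ w)))) (↔-sym e)
    where
    eq : ∀ w → w + + 1 - + 1 ≡ w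
    eq = solve-∀

  -- Square factors

  prime²∣-cancel : ∀ {q} g k → Prime q → ¬ q ∣ℕ g → q ℕ.* q ∣ℕ g ℕ.* k → q ℕ.* q ∣ℕ k
  prime²∣-cancel {q} g k qp q∤g h with euclidsLemma g k qp (ℕ∣.∣-trans (ℕ∣.m∣m*n q) h)
  ... | inj₁ q∣g = ⊥-elim (q∤g q∣g)
  ... | inj₂ (ℕ∣.divides j refl) = ℕ∣.*-monoˡ-∣ q ([ ⊥-elim ∘ q∤g , (λ i → i) ]′ (euclidsLemma g j qp
        (ℕ∣.*-cancelʳ-∣ q {{prime⇒nonZero qp}} (subst (q ℕ.* q ∣ℕ_) (sym (ℕ.*-assoc g j q)) h))))

  -- The primes q of D are moved into g one by one: if q did not divide g, then q² ∣ g² k would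
  -- force q² ∣ k. The lemma serves twice, for 5^α A dividing the gcd and for d dividing B.
  ²∣⇒∣ : ∀ D g k .{{_ : ℕ.NonZero D}} → (∀ q → Prime q → q ∣ℕ D → ¬ q ℕ.* q ∣ℕ k) →
         D ℕ.* D ∣ℕ g ℕ.* g ℕ.* k → D ∣ℕ g
  ²∣⇒∣ D g k sf h = subst (_∣ℕ g) (sym isFactorisation) (go factors factorsPrime g
    (λ q qp i → sf q qp (subst (q ∣ℕ_) (sym isFactorisation) i))
    (subst (λ D → D ℕ.* D ∣ℕ g ℕ.* g ℕ.* k) isFactorisation h))
    where
    open PrimeFactorisation (factorise D)
    go : ∀ qs → All Prime qs → ∀ g → (∀ q → Prime q → q ∣ℕ product qs → ¬ q ℕ.* q ∣ℕ k) →
         product qs ℕ.* product qs ∣ℕ g ℕ.* g ℕ.* k → product qs ∣ℕ g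
    go []       _          g _  _ = ℕ∣.1∣ g
    go (q ∷ qs) (qp ∷ qps) g sf h = by (q ℕ∣.∣? g)
      where
      P = product qs
      instance
        _ = prime⇒nonZero qp
        _ = ℕ.m*n≢0 q q
      eq₁ : ∀ q P → q ℕ.* P ℕ.* (q ℕ.* P) ≡ q ℕ.* q ℕ.* (P ℕ.* P)
      eq₁ = ℕSolver.solve-∀
      eq₂ : ∀ q g k → g ℕ.* q ℕ.* (g ℕ.* q) ℕ.* k ≡ q ℕ.* q ℕ.* (g ℕ.* g ℕ.* k)
      eq₂ = ℕSolver.solve-∀
      by : Dec (q ∣ℕ g) → q ℕ.* P ∣ℕ g
      by (no q∤g) = ⊥-elim (sf q qp (ℕ∣.m∣m*n P) (prime²∣-cancel g k qp q∤g (prime²∣-cancel g (g ℕ.* k) qp q∤g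
        (subst (q ℕ.* q ∣ℕ_) (ℕ.*-assoc g g k) (ℕ∣.∣-trans (subst (q ℕ.* q ∣ℕ_) (sym (eq₁ q P)) (ℕ∣.m∣m*n (P ℕ.* P))) h)))))
      by (yes (ℕ∣.divides g′ refl)) = subst (q ℕ.* P ∣ℕ_) (ℕ.*-comm q g′) (ℕ∣.*-monoʳ-∣ q
        (go qs qps g′ (λ r rp i → sf r rp (ℕ∣.∣n⇒∣m*n q i))
          (ℕ∣.*-cancelˡ-∣ (q ℕ.* q) (subst₂ _∣ℕ_ (eq₁ q P) (eq₂ q g′ k) h))))

  -- A prime factor that already divides C completes a square and moves to s; any other joins C.
  squareFreePart : ∀ k .{{_ : ℕ.NonZero k}} → ∃₂ λ s C → 0 ℕ.< s × SquareFree C × k ≡ s ℕ.* s ℕ.* C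
  squareFreePart k = subst (λ k → ∃₂ λ s C → 0 ℕ.< s × SquareFree C × k ≡ s ℕ.* s ℕ.* C) (sym isFactorisation) (go factors factorsPrime)
    where
    open PrimeFactorisation (factorise k)
    go : ∀ ps → All Prime ps → ∃₂ λ s C → 0 ℕ.< s × SquareFree C × product ps ≡ s ℕ.* s ℕ.* C
    go [] _ = 1 , 1 , ℕ.z<s , (λ p pp h → ¬prime[1] (subst Prime (ℕ∣.∣1⇒≡1 (ℕ∣.∣-trans (ℕ∣.m∣m*n p) h)) pp)) , refl
    go (p ∷ ps) (pp ∷ pps) with go ps pps
    ... | s , C , s>0 , sf , eq with p ℕ∣.∣? C
    ...   | yes (ℕ∣.divides C′ refl) = s ℕ.* p , C′ , ℕ.*-mono-≤ s>0 (ℕ.>-nonZero⁻¹ p {{prime⇒nonZero pp}}) ,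
            (λ q qp h → sf q qp (ℕ∣.∣m⇒∣m*n p h)) , trans (cong (p ℕ.*_) eq) (eq₁ p s C′)
      where
      eq₁ : ∀ p s C → p ℕ.* (s ℕ.* s ℕ.* (C ℕ.* p)) ≡ s ℕ.* p ℕ.* (s ℕ.* p) ℕ.* C
      eq₁ = ℕSolver.solve-∀
    ...   | no p∤C = s , p ℕ.* C , s>0 , sf′ , trans (cong (p ℕ.*_) eq) (eq₁ p s C)
      where
      eq₁ : ∀ p s C → p ℕ.* (s ℕ.* s ℕ.* C) ≡ s ℕ.* s ℕ.* (p ℕ.* C)
      eq₁ = ℕSolver.solve-∀
      sf′ : SquareFree (p ℕ.* C)
      sf′ q qp h with q ℕ∣.∣? p
      ... | no q∤p  = sf q qp (prime²∣-cancel p C qp q∤p h)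
      ... | yes q∣p with refl ← prime∣prime⇒≡ qp pp q∣p = p∤C (ℕ∣.*-cancelˡ-∣ p {{prime⇒nonZero pp}} h)

  Root-∣ : ∀ {k q} .{{_ : ℕ.NonZero q}} → Root k → q ∣ℕ k → Root q
  Root-∣ {q = q} (i , h) q∣k = toRoot q ⟦ i ⟧ (ℤ∣.∣-trans (∣⇒+∣+ q∣k) h)

  Root⇒NonInert : ∀ {k} → Root k → NonInert k
  Root⇒NonInert r q qp q∣k = Root⇒legendre5 (Root-∣ {{prime⇒nonZero qp}} r q∣k)

  Root⇒25∤ : ∀ {k} → Root k → ¬ 25 ∣ℕ k
  Root⇒25∤ (i , h) 25∣k = 25∤f ⟦ i ⟧ (ℤ∣.∣-trans (∣⇒+∣+ 25∣k) h)

  -- The substitution c = v + 3 b turns 1 + b² + c² = 3 b c + m with 3 b ≤ c into Q b v = m - 1 with v ≥ 0.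
  Sol : ℕ → Set
  Sol n = Σ (ℕ × ℕ) λ (b , v) → 1 ℕ.≤ b × Q b v ≡ n

  Sol-≡ : ∀ {n} {s t : Sol n} → proj₁ s ≡ proj₁ t → s ≡ t
  Sol-≡ {s = _ , a , b} {_ , a′ , b′} refl
    with refl ← ℕ.≤-irrelevant a a′ | refl ← ≡-irrelevant b b′ = refl

  Minimal-≡ : ∀ {m} {s t : MinimalTriplesWith1 m} → proj₁ s ≡ proj₁ t → s ≡ t
  Minimal-≡ {s = _ , e , (a , b , c , d) , x , y , z} {_ , e′ , (a′ , b′ , c′ , d′) , x′ , y′ , z′} refl
    with refl ← ≡-irrelevant e e′ | refl ← ℕ.≤-irrelevant a a′ | refl ← ℕ.≤-irrelevant b b′
       | refl ← ℕ.≤-irrelevant c c′ | refl ← ≡-irrelevant d d′ | refl ← ℕ.≤-irrelevant x x′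
       | refl ← ℕ.≤-irrelevant y y′ | refl ← ℕ.≤-irrelevant z z′ = refl

  markoff-eq : ∀ b v → 1 ℕ.* 1 ℕ.+ b ℕ.* b ℕ.+ (v ℕ.+ 3 ℕ.* b) ℕ.* (v ℕ.+ 3 ℕ.* b) ≡ 3 ℕ.* 1 ℕ.* b ℕ.* (v ℕ.+ 3 ℕ.* b) ℕ.+ (1 ℕ.+ Q b v)
  markoff-eq = eq
    where
    eq : ∀ b v → 1 ℕ.* 1 ℕ.+ b ℕ.* b ℕ.+ (v ℕ.+ 3 ℕ.* b) ℕ.* (v ℕ.+ 3 ℕ.* b) ≡
         3 ℕ.* 1 ℕ.* b ℕ.* (v ℕ.+ 3 ℕ.* b) ℕ.+ (1 ℕ.+ (b ℕ.* b ℕ.+ 3 ℕ.* b ℕ.* v ℕ.+ v ℕ.* v))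
    eq = ℕSolver.solve-∀

  Sol↔Minimal : ∀ n → Sol n ↔ MinimalTriplesWith1 (suc n)
  Sol↔Minimal n = mk↔ₛ′ to from to-from from-to
    where
    to : Sol n → MinimalTriplesWith1 (suc n)
    to ((b , v) , 1≤b , eq) = (1 , b , v ℕ.+ 3 ℕ.* b) , refl ,
      (ℕ.≤-refl , 1≤b , ℕ.≤-trans 1≤b b≤c , trans (markoff-eq b v) (cong (λ n → 3 ℕ.* 1 ℕ.* b ℕ.* (v ℕ.+ 3 ℕ.* b) ℕ.+ suc n) eq)) ,
      1≤b , b≤c , ℕ.m≤n+m (3 ℕ.* b) v
      where
      b≤c : b ℕ.≤ v ℕ.+ 3 ℕ.* b
      b≤c = ℕ.≤-trans (ℕ.m≤m+n b _) (ℕ.m≤n+m (3 ℕ.* b) v)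
    from : MinimalTriplesWith1 (suc n) → Sol n
    from ((_ , b , c) , refl , (_ , 1≤b , _ , eq) , _ , _ , 3b≤c) = (b , c ℕ.∸ 3 ℕ.* b) , 1≤b ,
      ℕ.suc-injective (ℕ.+-cancelˡ-≡ (3 ℕ.* 1 ℕ.* b ℕ.* c) _ _ (trans
        (trans (cong (λ d → 3 ℕ.* 1 ℕ.* b ℕ.* d ℕ.+ suc (Q b v)) (sym c≡))
          (trans (sym (markoff-eq b v)) (cong (λ d → 1 ℕ.* 1 ℕ.+ b ℕ.* b ℕ.+ d ℕ.* d) c≡))) eq))
      where
      v = c ℕ.∸ 3 ℕ.* b
      c≡ : v ℕ.+ 3 ℕ.* b ≡ c
      c≡ = ℕ.m∸n+n≡m 3b≤c
    to-from : ∀ t → to (from t) ≡ t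
    to-from ((_ , b , c) , refl , _ , _ , _ , 3b≤c) = Minimal-≡ (cong (λ c → 1 , b , c) (ℕ.m∸n+n≡m 3b≤c))
    from-to : ∀ s → from (to s) ≡ s
    from-to ((b , v) , _) = Sol-≡ (cong (b ,_) (ℕ.m+n∸n≡m v (3 ℕ.* b)))

  -- Splitting off the common divisor of a pair

  record PrimitivePart (b c : ℕ) : Set where
    constructor primitivePart
    field
      {g b₀ c₀} : ℕ
      b≡       : b ≡ g ℕ.* b₀
      c≡       : c ≡ g ℕ.* c₀
      1≤b₀     : 1 ℕ.≤ b₀
      1≤g      : 1 ℕ.≤ g
      coprime  : gcd b₀ c₀ ≡ 1

  primitivePartOf : ∀ b c → 1 ℕ.≤ b → PrimitivePart b c
  primitivePartOf b c 1≤b = go (gcd[m,n]∣m b c) (gcd[m,n]∣n b c) refl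
    where
    go : ∀ {g} → g ∣ℕ b → g ∣ℕ c → g ≡ gcd b c → PrimitivePart b c
    go {g} (ℕ∣.divides b₀ refl) (ℕ∣.divides c₀ refl) e =
      primitivePart (ℕ.*-comm b₀ g) (ℕ.*-comm c₀ g) (ℕ.>-nonZero⁻¹ b₀ {{ℕ.m*n≢0⇒m≢0 b₀}}) (ℕ.>-nonZero⁻¹ g)
        (ℕ.*-cancelˡ-≡ _ _ g (trans (c*gcd[m,n]≡gcd[cm,cn] g b₀ c₀)
          (trans (cong₂ gcd (ℕ.*-comm g b₀) (ℕ.*-comm g c₀)) (trans (sym e) (sym (ℕ.*-identityʳ g))))))
      where
      instance
        bg≢0 : ℕ.NonZero (b₀ ℕ.* g)
        bg≢0 = ℕ.>-nonZero 1≤b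
        g≢0 : ℕ.NonZero g
        g≢0 = ℕ.m*n≢0⇒n≢0 b₀

  Q-* : ∀ g b v → Q (g ℕ.* b) (g ℕ.* v) ≡ g ℕ.* g ℕ.* Q b v
  Q-* = eq
    where
    eq : ∀ g b v → g ℕ.* b ℕ.* (g ℕ.* b) ℕ.+ 3 ℕ.* (g ℕ.* b) ℕ.* (g ℕ.* v) ℕ.+ g ℕ.* v ℕ.* (g ℕ.* v) ≡
         g ℕ.* g ℕ.* (b ℕ.* b ℕ.+ 3 ℕ.* b ℕ.* v ℕ.+ v ℕ.* v)
    eq = ℕSolver.solve-∀

  sum↔ : ∀ (F : ℕ → ℕ) ks → Fin (sum (map F ks)) ↔ Σ ℕ λ k → k ∈ ks × Fin (F k)
  sum↔ F []       = mk↔ₛ′ (λ ()) (λ ()) (λ ()) (λ ())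
  sum↔ F (k ∷ ks) = ↔-trans Fin.+↔⊎ (↔-trans (↔-refl ⊎-↔ sum↔ F ks) (mk↔ₛ′
    (λ { (inj₁ i) → k , here refl , i ; (inj₂ (j , h , i)) → j , there h , i })
    (λ { (_ , here refl , i) → inj₁ i ; (j , there h , i) → inj₂ (j , h , i) })
    (λ { (_ , here refl , i) → refl ; (j , there h , i) → refl })
    (λ { (inj₁ i) → refl ; (inj₂ (j , h , i)) → refl })))

  -- Assembling the layers of common divisors

  module _ {n} {{_ : ℕ.NonZero n}} where

    -- After division by g², the pair (b₀, -c₀) is primitive with Q-value k, so its slope is a root
    -- modulo k. That root excludes inert primes from k, hence from its square-free part; g and s
    -- together form S.
    triple⇒decomposition : (∃₂ λ b c → MarkoffTriple (suc n) (1 , b , c)) →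
      ∃₂ λ S C → 0 ℕ.< S × SquareFree C × NonInert C × n ≡ S ℕ.* S ℕ.* C
    triple⇒decomposition (b , c , _ , 1≤b , _ , eq) with primitivePartOf b c 1≤b
    ... | primitivePart {g} {b₀} {c₀} refl refl _ 1≤g coprime = g ℕ.* s , C , ℕ.*-mono-≤ 1≤g s>0 , sf ,
            (λ p pp p∣C → Root⇒NonInert root p pp (subst (p ∣ℕ_) (sym k≡) (ℕ∣.∣n⇒∣m*n (s ℕ.* s) p∣C))) ,
            trans n≡ (trans (cong (g ℕ.* g ℕ.*_) k≡) (eq₃ g s C))
      where
      instance
        g≢0 : ℕ.NonZero g
        g≢0 = ℕ.>-nonZero 1≤g
        gg≢0 : ℕ.NonZero (g ℕ.* g)
        gg≢0 = ℕ.m*n≢0 g g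
      eq₁ : ∀ g b c → g ℕ.* g ℕ.* (b ℕ.* b ℕ.+ c ℕ.* c) ≡ g ℕ.* b ℕ.* (g ℕ.* b) ℕ.+ g ℕ.* c ℕ.* (g ℕ.* c)
      eq₁ = ℕSolver.solve-∀
      eq₂ : ∀ g b c n → 3 ℕ.* 1 ℕ.* (g ℕ.* b) ℕ.* (g ℕ.* c) ℕ.+ (1 ℕ.+ n) ≡ 1 ℕ.+ (g ℕ.* g ℕ.* (3 ℕ.* b ℕ.* c) ℕ.+ n)
      eq₂ = ℕSolver.solve-∀
      eq₃ : ∀ g s C → g ℕ.* g ℕ.* (s ℕ.* s ℕ.* C) ≡ g ℕ.* s ℕ.* (g ℕ.* s) ℕ.* C
      eq₃ = ℕSolver.solve-∀
      h : g ℕ.* g ℕ.* (b₀ ℕ.* b₀ ℕ.+ c₀ ℕ.* c₀) ≡ g ℕ.* g ℕ.* (3 ℕ.* b₀ ℕ.* c₀) ℕ.+ n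
      h = trans (eq₁ g b₀ c₀) (ℕ.suc-injective (trans eq (eq₂ g b₀ c₀ n)))
      gg∣n : g ℕ.* g ∣ℕ n
      gg∣n = ℕ∣.∣m+n∣m⇒∣n (subst (g ℕ.* g ∣ℕ_) h (ℕ∣.m∣m*n _)) (ℕ∣.m∣m*n (3 ℕ.* b₀ ℕ.* c₀))
      k = ℕ∣.quotient gg∣n
      n≡ : n ≡ g ℕ.* g ℕ.* k
      n≡ = ℕ∣.m∣n⇒n≡m*quotient gg∣n
      instance
        k≢0 : ℕ.NonZero k
        k≢0 = ℕ.m*n≢0⇒n≢0 (g ℕ.* g) {{subst ℕ.NonZero n≡ it}}
      hk : b₀ ℕ.* b₀ ℕ.+ c₀ ℕ.* c₀ ≡ 3 ℕ.* b₀ ℕ.* c₀ ℕ.+ k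
      hk = ℕ.*-cancelˡ-≡ _ _ (g ℕ.* g) (trans h (trans (cong (g ℕ.* g ℕ.* (3 ℕ.* b₀ ℕ.* c₀) ℕ.+_) n≡)
             (sym (ℕ.*-distribˡ-+ (g ℕ.* g) (3 ℕ.* b₀ ℕ.* c₀) k))))
      eq₄ : ∀ b c → Qℤ b (- c) ≡ b * b + c * c - + 3 * b * c
      eq₄ = go
        where
        go : ∀ b c → b * b + + 3 * b * - c + - c * - c ≡ b * b + c * c - + 3 * b * c
        go = solve-∀
      eq₅ : ∀ x k → x + k - x ≡ k
      eq₅ = solve-∀
      hℤ : Qℤ (+ b₀) (- + c₀) ≡ + k
      hℤ = trans (eq₄ (+ b₀) (+ c₀)) (trans (cong₂ _-_ (trans (sym (cong₂ _+_ (ℤ.pos-* b₀ b₀) (ℤ.pos-* c₀ c₀))) (cong +_ hk))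
             (sym (trans (ℤ.pos-* (3 ℕ.* b₀) c₀) (cong (_* + c₀) (ℤ.pos-* 3 b₀))))) (eq₅ (+ (3 ℕ.* b₀ ℕ.* c₀)) (+ k)))
      bez : Bézoutℤ (+ b₀) (- + c₀)
      bez with coprime⇒Bézoutℤ (gcd≡1⇒coprime coprime)
      ... | s , t , e = s , - t , trans (go s t (+ b₀) (+ c₀)) e
        where
        go : ∀ s t b c → s * b + - t * - c ≡ s * b + t * c
        go = solve-∀
      root : Root k
      root = toRoot k (proj₁ sl) (proj₁ (proj₂ sl))
        where sl = slope (+ b₀) (- + c₀) bez hℤ
      part = squareFreePart k
      s = proj₁ part
      C = proj₁ (proj₂ part)
      s>0 = proj₁ (proj₂ (proj₂ part))
      sf = proj₁ (proj₂ (proj₂ (proj₂ part)))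
      k≡ = proj₂ (proj₂ (proj₂ (proj₂ part)))

    -- A root modulo C gives a primitive pair of value C, and scaling by S multiplies the value by
    -- S². Square-freeness rules out 25, the one obstruction that `NonInert` leaves.
    decomposition⇒triple : (∃₂ λ S C → 0 ℕ.< S × SquareFree C × NonInert C × n ≡ S ℕ.* S ℕ.* C) →
      ∃₂ λ b c → MarkoffTriple (suc n) (1 , b , c)
    decomposition⇒triple (S , C , S>0 , sf , l , n≡) = extract (Inverse.to (Sol↔Minimal n) sol)
      where
      instance
        C≢0 : ℕ.NonZero C
        C≢0 = ℕ.m*n≢0⇒n≢0 (S ℕ.* S) {{subst ℕ.NonZero n≡ it}}
      sol : Sol n
      sol with proj₁ (Root⇒Prim (squareFree-root C l sf))
      ... | (b , v) , 1≤b , _ , Q≡C = (S ℕ.* b , S ℕ.* v) , ℕ.*-mono-≤ S>0 1≤b ,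
        trans (Q-* S b v) (trans (cong (S ℕ.* S ℕ.*_) Q≡C) (sym n≡))
      extract : MinimalTriplesWith1 (suc n) → ∃₂ λ b c → MarkoffTriple (suc n) (1 , b , c)
      extract ((_ , b , c) , refl , t , _) = b , c , t

  module _ {n} {{n≢0 : ℕ.NonZero n}} α A B C (sf : SquareFree C) (lC : NonInert C)
           (lB : ∀ p → Prime p → p ∣ℕ B → legendre5 p ≡ + 1)
           (lA : ∀ p → Prime p → p ∣ℕ A → legendre5 p ≡ -[1+ 0 ])
           (n≡ : n ≡ 5 ℕ.^ (2 ℕ.* α) ℕ.* (A ℕ.* A) ℕ.* (B ℕ.* B) ℕ.* C) where

    private
      D BBC : ℕ
      D = 5 ℕ.^ α ℕ.* A
      BBC = B ℕ.* B ℕ.* C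

      n≡DDBBC : n ≡ D ℕ.* D ℕ.* BBC
      n≡DDBBC = trans n≡ (trans (cong (λ q → q ℕ.* (A ℕ.* A) ℕ.* (B ℕ.* B) ℕ.* C)
        (trans (cong (λ β → 5 ℕ.^ (α ℕ.+ β)) (ℕ.+-identityʳ α)) (ℕ.^-distribˡ-+-* 5 α α))) (eq (5 ℕ.^ α) A B C))
        where
        eq : ∀ q A B C → q ℕ.* q ℕ.* (A ℕ.* A) ℕ.* (B ℕ.* B) ℕ.* C ≡ q ℕ.* A ℕ.* (q ℕ.* A) ℕ.* (B ℕ.* B ℕ.* C)
        eq = ℕSolver.solve-∀

      instance
        DDBBC≢0 : ℕ.NonZero (D ℕ.* D ℕ.* BBC)
        DDBBC≢0 = subst ℕ.NonZero n≡DDBBC n≢0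
        BBC≢0 : ℕ.NonZero BBC
        BBC≢0 = ℕ.m*n≢0⇒n≢0 (D ℕ.* D)
        DD≢0 : ℕ.NonZero (D ℕ.* D)
        DD≢0 = ℕ.m*n≢0⇒m≢0 (D ℕ.* D)
        D≢0 : ℕ.NonZero D
        D≢0 = ℕ.m*n≢0⇒n≢0 D
        C≢0 : ℕ.NonZero C
        C≢0 = ℕ.m*n≢0⇒n≢0 (B ℕ.* B)
        BB≢0 : ℕ.NonZero (B ℕ.* B)
        BB≢0 = ℕ.m*n≢0⇒m≢0 (B ℕ.* B) {C}
        B≢0 : ℕ.NonZero B
        B≢0 = ℕ.m*n≢0⇒n≢0 B

      5∤B : ¬ 5 ∣ℕ B
      5∤B h with () ← lB 5 prime[5] h

      5∣BBC⇒5∣C : 5 ∣ℕ BBC → 5 ∣ℕ C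
      5∣BBC⇒5∣C h = [ ⊥-elim ∘ 5∤B ∘ Sum.reduce ∘ euclidsLemma B B prime[5] , (λ i → i) ]′ (euclidsLemma (B ℕ.* B) C prime[5] h)

      BBC-nonInert : NonInert BBC
      BBC-nonInert p pp h e = [ inB ∘ Sum.reduce ∘ euclidsLemma B B pp , (λ i → lC p pp i e) ]′ (euclidsLemma (B ℕ.* B) C pp h)
        where
        inB : ¬ p ∣ℕ B
        inB i with () ← trans (sym e) (lB p pp i)

      -- `divisorsPred` lists d - 1 for the divisors d, so here d is `suc e`, visibly non-zero.
      cofactor : ℕ → ℕ
      cofactor e = BBC / (suc e ℕ.* suc e)

      module _ {e} (e∈ : e ∈ divisorsPred B) where

        e∣B : suc e ∣ℕ B
        e∣B = proj₂ (∈-filter⁻ (λ k → suc k ℕ∣.∣? B) {xs = upTo B} e∈)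

        cofactor-* : cofactor e ℕ.* (suc e ℕ.* suc e) ≡ BBC
        cofactor-* = m/n*n≡m (ℕ∣.∣m⇒∣m*n C (ℕ∣.*-pres-∣ e∣B e∣B))

        cofactor∣BBC : cofactor e ∣ℕ BBC
        cofactor∣BBC = subst (cofactor e ∣ℕ_) cofactor-* (ℕ∣.m∣m*n _)

        instance
          cofactor≢0 : ℕ.NonZero (cofactor e)
          cofactor≢0 = ℕ.m*n≢0⇒m≢0 (cofactor e) {{subst ℕ.NonZero (sym cofactor-*) BBC≢0}}

        5∣C⇒5∣cofactor : 5 ∣ℕ C → 5 ∣ℕ cofactor e
        5∣C⇒5∣cofactor h = [ (λ i → i) , ⊥-elim ∘ 5∤B ∘ (λ i → ℕ∣.∣-trans i e∣B) ∘ Sum.reduce ∘ euclidsLemma (suc e) (suc e) prime[5] ]′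
          (euclidsLemma (cofactor e) _ prime[5] (subst (5 ∣ℕ_) (sym cofactor-*) (ℕ∣.∣n⇒∣m*n (B ℕ.* B) h)))

        25∤cofactor : ¬ 25 ∣ℕ cofactor e
        25∤cofactor h = SquareFree⇒25∤ sf (prime²∣-cancel B C prime[5] 5∤B (prime²∣-cancel B (B ℕ.* C) prime[5] 5∤B
          (subst (25 ∣ℕ_) (ℕ.*-assoc B B C) (ℕ∣.∣-trans h cofactor∣BBC))))

        prim-count : Fin (2 ℕ.^ ℤ.∣ + ω (cofactor e) + legendre5 C - + 1 ∣) ↔ Prim (cofactor e)
        prim-count = ↔-trans (root-count-legendre (cofactor e) C (λ p pp h → BBC-nonInert p pp (ℕ∣.∣-trans h cofactor∣BBC)) 25∤cofactor
          (λ h → 5∣BBC⇒5∣C (ℕ∣.∣-trans h cofactor∣BBC)) 5∣C⇒5∣cofactor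
          -- The symbol of C is seen not to be -1 without multiplicativity: C has a root, so it is a
          -- value of Q, hence a square modulo 5.
          (Root⇒legendre5 (squareFree-root C lC sf))) (↔-sym (Prim↔Root (cofactor e)))

      Layers : Set
      Layers = Σ ℕ λ e → e ∈ divisorsPred B × Prim (cofactor e)

      Layers-≡ : ∀ {e e′ b b′ v v′ i i′ p p′} → e ≡ e′ → b ≡ b′ → v ≡ v′ →
                 _≡_ {A = Layers} (e , i , (b , v) , p) (e′ , i′ , (b′ , v′) , p′)
      Layers-≡ {e} {i = i} {i′} refl refl refl = cong₂ (λ i p → e , i , p)
        (unique⇒irrelevant (Unique.filter⁺ (λ k → suc k ℕ∣.∣? B) (Unique.upTo⁺ B)) i i′) (Prim-≡ refl)

      -- The quotient k has a root, so neither 25 nor the square of an inert prime divides it.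
      D∣ : ∀ g {k} → Root k → n ≡ g ℕ.* g ℕ.* k → D ∣ℕ g
      D∣ g {k} r eq = ²∣⇒∣ D g k sf′ (subst (D ℕ.* D ∣ℕ_) (trans (sym n≡DDBBC) eq) (ℕ∣.m∣m*n BBC))
        where
        prime∣5^ : ∀ β q → Prime q → q ∣ℕ 5 ℕ.^ β → q ≡ 5
        prime∣5^ zero    q qp h = ⊥-elim (¬prime[1] (subst Prime (ℕ∣.∣1⇒≡1 h) qp))
        prime∣5^ (suc β) q qp h = [ prime∣prime⇒≡ qp prime[5] , prime∣5^ β q qp ]′ (euclidsLemma 5 (5 ℕ.^ β) qp h)
        sf′ : ∀ q → Prime q → q ∣ℕ D → ¬ q ℕ.* q ∣ℕ k
        sf′ q qp q∣D qq∣k = [ (λ h → Root⇒25∤ r (subst (λ q → q ℕ.* q ∣ℕ k) (prime∣5^ α q qp h) qq∣k)) ,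
                              (λ h → Root⇒NonInert r q qp (ℕ∣.∣-trans (ℕ∣.m∣m*n q) qq∣k) (lA q qp h)) ]′
                            (euclidsLemma (5 ℕ.^ α) A qp q∣D)

      -- The factorisations of b and v are fields, so that an arbitrary decomposition of a given
      -- pair can be compared with a known one.
      record Layer (b v : ℕ) : Set where
        constructor layer
        field
          {e b₀ v₀} : ℕ
          e∈        : e ∈ divisorsPred B
          1≤b₀      : 1 ℕ.≤ b₀
          coprime   : gcd b₀ v₀ ≡ 1
          Q≡        : Q b₀ v₀ ≡ cofactor e
          b≡        : b ≡ D ℕ.* suc e ℕ.* b₀
          v≡        : v ≡ D ℕ.* suc e ℕ.* v₀

      layerOf : ∀ b v → 1 ℕ.≤ b → Q b v ≡ n → Layer b v
      layerOf b v 1≤b Qn with primitivePartOf b v 1≤b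
      ... | primitivePart {g} {b₀} {v₀} refl refl 1≤b₀ 1≤g coprime = go (D∣ g root n≡ggk) n≡ggk
        where
        n≡ggk : n ≡ g ℕ.* g ℕ.* Q b₀ v₀
        n≡ggk = trans (sym Qn) (Q-* g b₀ v₀)
        instance
          k≢0 : ℕ.NonZero (Q b₀ v₀)
          k≢0 = ℕ.m*n≢0⇒n≢0 (g ℕ.* g) {{subst ℕ.NonZero n≡ggk n≢0}}
        root : Root (Q b₀ v₀)
        root = Inverse.to (Prim↔Root (Q b₀ v₀)) ((b₀ , v₀) , 1≤b₀ , coprime , refl)
        go : D ∣ℕ g → n ≡ g ℕ.* g ℕ.* Q b₀ v₀ → Layer (g ℕ.* b₀) (g ℕ.* v₀)
        -- Quotient 0 would make the gcd, and with it n, equal to 0.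
        go (ℕ∣.divides zero refl) e = ⊥-elim (ℕ.≢-nonZero⁻¹ n {{n≢0}} e)
        go (ℕ∣.divides (suc e) refl) eq = layer e∈ 1≤b₀ coprime Q≡
          (cong (ℕ._* b₀) (ℕ.*-comm (suc e) D)) (cong (ℕ._* v₀) (ℕ.*-comm (suc e) D))
          where
          eq₁ : ∀ e D k → e ℕ.* D ℕ.* (e ℕ.* D) ℕ.* k ≡ D ℕ.* D ℕ.* (k ℕ.* (e ℕ.* e))
          eq₁ = ℕSolver.solve-∀
          kee : Q b₀ v₀ ℕ.* (suc e ℕ.* suc e) ≡ BBC
          kee = ℕ.*-cancelˡ-≡ _ _ (D ℕ.* D) (trans (sym (eq₁ (suc e) D (Q b₀ v₀))) (trans (sym eq) n≡DDBBC))
          Q≡ : Q b₀ v₀ ≡ cofactor e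
          Q≡ = trans (sym (m*n/n≡m (Q b₀ v₀) (suc e ℕ.* suc e))) (cong (_/ (suc e ℕ.* suc e)) kee)
          se∣B : suc e ∣ℕ B
          -- C is square-free, so d² ∣ B² C leaves no part of d to C.
          se∣B = ²∣⇒∣ (suc e) B C (λ q qp _ → sf q qp) (ℕ∣.divides (Q b₀ v₀) (sym kee))
          e∈ : e ∈ divisorsPred B
          e∈ = ∈-filter⁺ (λ k → suc k ℕ∣.∣? B) (∈-upTo⁺ (ℕ∣.∣⇒≤ se∣B)) se∣B

      Layers↔Sol : Layers ↔ Sol n
      Layers↔Sol = mk↔ₛ′ to from to-from from-to
        where
        to : Layers → Sol n
        to (e , e∈ , (b , v) , 1≤b , _ , Q≡) = (D ℕ.* suc e ℕ.* b , D ℕ.* suc e ℕ.* v) ,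
          ℕ.*-mono-≤ (ℕ.>-nonZero⁻¹ (D ℕ.* suc e) {{ℕ.m*n≢0 D (suc e)}}) 1≤b ,
          trans (Q-* (D ℕ.* suc e) b v) (trans (cong (D ℕ.* suc e ℕ.* (D ℕ.* suc e) ℕ.*_) Q≡)
            (trans (eq D (suc e) (cofactor e)) (trans (cong (D ℕ.* D ℕ.*_) (cofactor-* e∈)) (sym n≡DDBBC))))
          where
          eq : ∀ D e k → D ℕ.* e ℕ.* (D ℕ.* e) ℕ.* k ≡ D ℕ.* D ℕ.* (k ℕ.* (e ℕ.* e))
          eq = ℕSolver.solve-∀
        pack : ∀ {b v} → Layer b v → Layers
        pack (layer {e} {b₀} {v₀} e∈ 1≤b₀ coprime Q≡ _ _) = e , e∈ , (b₀ , v₀) , 1≤b₀ , coprime , Q≡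
        from : Sol n → Layers
        from ((b , v) , 1≤b , Qn) = pack (layerOf b v 1≤b Qn)
        to-from : ∀ s → to (from s) ≡ s
        to-from ((b , v) , 1≤b , Qn) = go (layerOf b v 1≤b Qn)
          where
          go : (l : Layer b v) → to (pack l) ≡ ((b , v) , 1≤b , Qn)
          go (layer _ _ _ _ refl refl) = Sol-≡ refl
        from-to : ∀ l → from (to l) ≡ l
        from-to (e , e∈ , (b , v) , 1≤b , coprime , Q≡) = go (layerOf (D ℕ.* suc e ℕ.* b) (D ℕ.* suc e ℕ.* v) _ _)
          where
          go : (l : Layer (D ℕ.* suc e ℕ.* b) (D ℕ.* suc e ℕ.* v)) → pack l ≡ (e , e∈ , (b , v) , 1≤b , coprime , Q≡)
          go (layer {e′} {b′} {v′} _ _ coprime′ _ b≡ v≡) = Layers-≡ e′≡e (same b b′ b≡) (same v v′ v≡)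
            where
            gcd-* : ∀ g b v → gcd b v ≡ 1 → gcd (g ℕ.* b) (g ℕ.* v) ≡ g
            gcd-* g b v c = trans (sym (c*gcd[m,n]≡gcd[cm,cn] g b v)) (trans (cong (g ℕ.*_) c) (ℕ.*-identityʳ g))
            -- The gcd of the pair is D d whenever the reduced pair is primitive, so the pair alone
            -- determines d.
            De≡ : D ℕ.* suc e′ ≡ D ℕ.* suc e
            De≡ = trans (sym (gcd-* (D ℕ.* suc e′) b′ v′ coprime′)) (trans (sym (cong₂ gcd b≡ v≡)) (gcd-* (D ℕ.* suc e) b v coprime))
            e′≡e : e′ ≡ e
            e′≡e = ℕ.suc-injective (ℕ.*-cancelˡ-≡ _ _ D De≡)
            same : ∀ x y → D ℕ.* suc e ℕ.* x ≡ D ℕ.* suc e′ ℕ.* y → y ≡ x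
            same x y h = sym (ℕ.*-cancelˡ-≡ x y (D ℕ.* suc e) {{ℕ.m*n≢0 D (suc e)}} (trans h (cong (ℕ._* y) De≡)))

      Σ-cong : {F G : ℕ → Set} → (∀ {e} → e ∈ divisorsPred B → F e ↔ G e) →
               (Σ ℕ λ e → e ∈ divisorsPred B × F e) ↔ (Σ ℕ λ e → e ∈ divisorsPred B × G e)
      Σ-cong h = Σ.congˡ (Σ.congˡ (λ {e∈} → h e∈))

    minimal-count : Fin (markoffCount B C) ↔ MinimalTriplesWith1 (suc n)
    minimal-count = ↔-trans (sum↔ _ (divisorsPred B)) (↔-trans (Σ-cong prim-count)
      (↔-trans Layers↔Sol (Sol↔Minimal n)))

open import Data.Nat using (ℕ; suc; s≤s; _+_; _*_; _∸_; _^_; _<_; >-nonZero)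
open import Data.Nat.Divisibility using (_∣_)
open import Data.Nat.Primality using (Prime)
open import Data.Integer using (ℤ; +_; -[1+_])
open import Data.Fin using (Fin)
open import Data.Product using (_×_; _,_; ∃; ∃₂; Σ)
open import Function.Bundles using (_⇔_; _↔_; mk⇔)
open import Relation.Binary.PropositionalEquality using (_≡_; _≢_)

theorem1p3 : (m : ℕ) → 1 < m →
    ((∃₂ λ b c → MarkoffTriple m (1 , b , c))
    ⇔ (∃₂ λ S C → 0 < S × SquareFree C
    × (∀ p → Prime p → p ∣ C → legendre5 p ≢ -[1+ 0 ])
    × m ∸ 1 ≡ S * S * C))
    × ((∃₂ λ b c → MarkoffTriple m (1 , b , c)) →
    ∀ α A B C → SquareFree C
    → (∀ p → Prime p → p ∣ C → legendre5 p ≢ -[1+ 0 ])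
    → (∀ p → Prime p → p ∣ B → legendre5 p ≡ + 1)
    → (∀ p → Prime p → p ∣ A → legendre5 p ≡ -[1+ 0 ])
    → m ∸ 1 ≡ 5 ^ (2 * α) * (A * A) * (B * B) * C
    → Fin (markoffCount B C) ↔ MinimalTriplesWith1 m)
theorem1p3 (suc n) (s≤s 0<n) =
  mk⇔ Development.triple⇒decomposition Development.decomposition⇒triple , λ _ → Development.minimal-count
  where instance _ = >-nonZero 0<n
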